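{- Let $H$ be a complex Hilbert space with $\dim H\ge 3$ (possibly infinite-dimensional), and let $k$ be an integer with $0<k<\dim H$ (any integer $k>0$ if $H$ is infinite-dimensional). Two $k$-dimensional subspaces $X,Y\subset H$ are compatible if and only if every geodesic of $\Gamma_k(H)$ connecting $X$ and $Y$ is a geodesic in $\Gamma^{\perp}_k(H)$.
   Context: Two $k$-dimensional subspaces of $H$ are adjacent if their intersection is $(k-1)$-dimensional (equivalently, their sum is $(k+1)$-dimensional). Two closed subspaces $X,Y\subset H$ are compatible if there is an orthonormal basis of $H$ such that $X$ and $Y$ are both spanned by subsets of this basis (equivalently, the orthogonal projections $P_X,P_Y$ commute). Two $k$-dimensional subspaces are ortho-adjacent if they are adjacent and compatible. The Grassmann graph $\Gamma_k(H)$ is the simple graph whose vertices are the $k$-dimensional subspaces of $H$ with edges joining adjacent subspaces; the ortho-Grassmann graph $\Gamma^{\perp}_k(H)$ has the same vertices, with edges joining ortho-adjacent subspaces. Both graphs are connected. In a connected simple graph, the distance $d(v,w)$ is the smallest length (number of edges) of a path connecting $v$ and $w$; a path connecting $v$ and $w$ is a geodesic if its length is $d(v,w)$. -}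

module Defs where

open import Algebra.Bundles using (CommutativeRing)
open import Algebra.Consequences.Setoid using (comm∧idˡ⇒id; comm∧distrˡ⇒distr)
open import Algebra.Definitions using (Congruent₂; Commutative; LeftIdentity; _DistributesOverˡ_)
open import Algebra.Module.Bundles using (LeftModule)
import Algebra.Properties.CommutativeMonoid.Sum as Sum
import Algebra.Properties.Ring as RingProperties
import Algebra.Solver.Ring.NaturalCoefficients.Default as NaturalCoefficients
open import Data.Fin using (Fin; zero; suc; inject₁; fromℕ)
import Data.Nat as ℕ
open import Data.Nat using (ℕ; suc)
open import Data.Product using (Σ; ∃; ∃-syntax; _×_; _,_; proj₁; proj₂)
open import Data.Product.Relation.Binary.Pointwise.NonDependent using (Pointwise; ×-isEquivalence)
open import Data.Sum using (_⊎_)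
open import Data.Vec.Functional using (Vector)
open import Level using (Level; _⊔_) renaming (suc to lsuc)
open import Relation.Binary using (Rel; IsEquivalence; IsTotalOrder; Poset; Setoid)
import Relation.Binary.Construct.NonStrictToStrict as Strict
import Relation.Binary.Construct.On as On
import Relation.Binary.Reasoning.Setoid as SetoidReasoning
open import Relation.Binary.PropositionalEquality using (_≡_)
open import Relation.Nullary using (¬_)
open import Relation.Unary using (Pred; _∈_; _⊆_; _≐_; _∩_)
open import Relation.Unary.Relation.Binary.Equality using (≐-setoid)

module _ {c ℓ₁ ℓ₂ : Level} (P : Poset c ℓ₁ ℓ₂) where
  open Poset P

  IsChain : ∀ {p} → Pred Carrier p → Set (c ⊔ ℓ₂ ⊔ p)
  IsChain C = ∀ {x y} → x ∈ C → y ∈ C → x ≤ y ⊎ y ≤ x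

  IsMaximal : Carrier → Set (c ⊔ ℓ₁ ⊔ ℓ₂)
  IsMaximal m = ∀ x → m ≤ x → x ≈ m

-- Stated separately from excluded middle, because the choices that
-- ExcludedMiddle provides need not respect a setoid equality.
ZornsLemma : ∀ c ℓ₁ ℓ₂ → Set (lsuc (c ⊔ ℓ₁ ⊔ ℓ₂))
ZornsLemma c ℓ₁ ℓ₂ = (P : Poset c ℓ₁ ℓ₂) → let open Poset P in
  ((C : Pred Carrier ℓ₂) → IsChain P C → ∃[ u ] (∀ x → x ∈ C → x ≤ u)) →
  ∃[ m ] IsMaximal P m

-- The real numbers, by their second-order axioms: classically these have
-- exactly one model up to isomorphism.
record RealNumbers ℓ : Set (lsuc ℓ) where
  field
    commutativeRing : CommutativeRing ℓ ℓ

  open CommutativeRing commutativeRing public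

  infix 4 _≤_

  field
    _≤_          : Rel Carrier ℓ
    isTotalOrder : IsTotalOrder _≈_ _≤_
    0≉1          : ¬ 0# ≈ 1#
    inverse      : ∀ x → ¬ x ≈ 0# → ∃[ y ] x * y ≈ 1#
    +-monoˡ-≤    : ∀ {x y} z → x ≤ y → x + z ≤ y + z
    *-nonNeg     : ∀ {x y} → 0# ≤ x → 0# ≤ y → 0# ≤ x * y

  IsUpperBound : Pred Carrier ℓ → Carrier → Set ℓ
  IsUpperBound S b = ∀ x → x ∈ S → x ≤ b

  field
    supremum : (S : Pred Carrier ℓ) → (∃[ x ] x ∈ S) → (∃[ b ] IsUpperBound S b) →
               ∃[ s ] (IsUpperBound S s × (∀ b → IsUpperBound S b → s ≤ b))

  open Strict _≈_ _≤_ public using (_<_)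

-- With m in place of - 1# the ring laws of ℂ are semiring identities, which
-- the solver can prove without deciding equality of coefficients.
private module SemiringIdentities {r ℓ} (R : CommutativeRing r ℓ) where
  open CommutativeRing R using (commutativeSemiring; refl; _≈_; _+_; _*_; 0#; 1#)
  open NaturalCoefficients commutativeSemiring using (solve; con; _:+_; _:*_; _:=_)

  *-assoc-re : ∀ m a b c d e f →
    (a * c + m * (b * d)) * e + m * ((a * d + b * c) * f) ≈
    a * (c * e + m * (d * f)) + m * (b * (c * f + d * e))
  *-assoc-re = solve 7 (λ m a b c d e f →
    (a :* c :+ m :* (b :* d)) :* e :+ m :* ((a :* d :+ b :* c) :* f) :=
    a :* (c :* e :+ m :* (d :* f)) :+ m :* (b :* (c :* f :+ d :* e))) refl

  *-assoc-im : ∀ m a b c d e f →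
    (a * c + m * (b * d)) * f + (a * d + b * c) * e ≈
    a * (c * f + d * e) + b * (c * e + m * (d * f))
  *-assoc-im = solve 7 (λ m a b c d e f →
    (a :* c :+ m :* (b :* d)) :* f :+ (a :* d :+ b :* c) :* e :=
    a :* (c :* f :+ d :* e) :+ b :* (c :* e :+ m :* (d :* f))) refl

  *-identityˡ-re : ∀ m a b → 1# * a + m * (0# * b) ≈ a
  *-identityˡ-re = solve 3 (λ m a b → con 1 :* a :+ m :* (con 0 :* b) := a) refl

  *-identityˡ-im : ∀ a b → 1# * b + 0# * a ≈ b
  *-identityˡ-im = solve 2 (λ a b → con 1 :* b :+ con 0 :* a := b) refl

  distribˡ-re : ∀ m a b c d e f →
    a * (c + e) + m * (b * (d + f)) ≈ (a * c + m * (b * d)) + (a * e + m * (b * f))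
  distribˡ-re = solve 7 (λ m a b c d e f →
    a :* (c :+ e) :+ m :* (b :* (d :+ f)) :=
    (a :* c :+ m :* (b :* d)) :+ (a :* e :+ m :* (b :* f))) refl

  distribˡ-im : ∀ a b c d e f →
    a * (d + f) + b * (c + e) ≈ (a * d + b * c) + (a * f + b * e)
  distribˡ-im = solve 6 (λ a b c d e f →
    a :* (d :+ f) :+ b :* (c :+ e) := (a :* d :+ b :* c) :+ (a :* f :+ b :* e)) refl

  *-comm-im : ∀ a b c d → a * d + b * c ≈ c * b + d * a
  *-comm-im = solve 4 (λ a b c d → a :* d :+ b :* c := c :* b :+ d :* a) refl

private module ComplexRingLaws {r ℓ} (R : CommutativeRing r ℓ) where
  open CommutativeRing R
  open RingProperties ring using (-1*x≈-x)
  open SetoidReasoning setoid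
  module Generic = SemiringIdentities R

  minus : ∀ x y → x + - 1# * y ≈ x - y
  minus x y = +-congˡ (-1*x≈-x y)

  *-assoc-re : ∀ a b c d e f →
    (a * c - b * d) * e - (a * d + b * c) * f ≈ a * (c * e - d * f) - b * (c * f + d * e)
  *-assoc-re a b c d e f = begin
    (a * c - b * d) * e - (a * d + b * c) * f
      ≈⟨ trans (minus _ _) (+-congʳ (*-congʳ (minus _ _))) ⟨
    (a * c + - 1# * (b * d)) * e + - 1# * ((a * d + b * c) * f)
      ≈⟨ Generic.*-assoc-re (- 1#) a b c d e f ⟩
    a * (c * e + - 1# * (d * f)) + - 1# * (b * (c * f + d * e))
      ≈⟨ trans (minus _ _) (+-congʳ (*-congˡ (minus _ _))) ⟩
    a * (c * e - d * f) - b * (c * f + d * e) ∎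

  *-assoc-im : ∀ a b c d e f →
    (a * c - b * d) * f + (a * d + b * c) * e ≈ a * (c * f + d * e) + b * (c * e - d * f)
  *-assoc-im a b c d e f = begin
    (a * c - b * d) * f + (a * d + b * c) * e
      ≈⟨ +-congʳ (*-congʳ (minus _ _)) ⟨
    (a * c + - 1# * (b * d)) * f + (a * d + b * c) * e
      ≈⟨ Generic.*-assoc-im (- 1#) a b c d e f ⟩
    a * (c * f + d * e) + b * (c * e + - 1# * (d * f))
      ≈⟨ +-congˡ (*-congˡ (minus _ _)) ⟩
    a * (c * f + d * e) + b * (c * e - d * f) ∎

  *-identityˡ-re : ∀ a b → 1# * a - 0# * b ≈ a
  *-identityˡ-re a b = trans (sym (minus _ _)) (Generic.*-identityˡ-re (- 1#) a b)

  *-identityˡ-im : ∀ a b → 1# * b + 0# * a ≈ b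
  *-identityˡ-im = Generic.*-identityˡ-im

  distribˡ-re : ∀ a b c d e f →
    a * (c + e) - b * (d + f) ≈ (a * c - b * d) + (a * e - b * f)
  distribˡ-re a b c d e f = begin
    a * (c + e) - b * (d + f)
      ≈⟨ minus _ _ ⟨
    a * (c + e) + - 1# * (b * (d + f))
      ≈⟨ Generic.distribˡ-re (- 1#) a b c d e f ⟩
    (a * c + - 1# * (b * d)) + (a * e + - 1# * (b * f))
      ≈⟨ +-cong (minus _ _) (minus _ _) ⟩
    (a * c - b * d) + (a * e - b * f) ∎

  distribˡ-im : ∀ a b c d e f →
    a * (d + f) + b * (c + e) ≈ (a * d + b * c) + (a * f + b * e)
  distribˡ-im = Generic.distribˡ-im

  *-comm-re : ∀ a b c d → a * c - b * d ≈ c * a - d * b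
  *-comm-re a b c d = +-cong (*-comm a c) (-‿cong (*-comm b d))

  *-comm-im : ∀ a b c d → a * d + b * c ≈ c * b + d * a
  *-comm-im = Generic.*-comm-im

module Complex {ℓ} (ℝ : RealNumbers ℓ) where
  private
    module ℝ = RealNumbers ℝ
    open ℝ using (Carrier; _≈_; 0#; 1#; _+_; _*_; -_; _-_)
    module Laws = ComplexRingLaws ℝ.commutativeRing

  ℂ : Set ℓ
  ℂ = Carrier × Carrier

  Re Im : ℂ → Carrier
  Re = proj₁
  Im = proj₂

  infix  4 _≈ℂ_
  infixl 6 _+ℂ_
  infixl 7 _*ℂ_

  _≈ℂ_ : Rel ℂ ℓ
  _≈ℂ_ = Pointwise _≈_ _≈_

  _+ℂ_ _*ℂ_ : ℂ → ℂ → ℂ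
  (a , b) +ℂ (c , d) = a + c , b + d
  (a , b) *ℂ (c , d) = a * c - b * d , a * d + b * c

  -ℂ_ conj : ℂ → ℂ
  -ℂ (a , b) = - a , - b
  conj (a , b) = a , - b

  0ℂ 1ℂ : ℂ
  0ℂ = 0# , 0#
  1ℂ = 1# , 0#

  private
    ×-isEq : IsEquivalence _≈ℂ_
    ×-isEq = ×-isEquivalence ℝ.isEquivalence ℝ.isEquivalence

    ℂ-setoid : Setoid ℓ ℓ
    ℂ-setoid = record { isEquivalence = ×-isEq }

    +ℂ-cong : Congruent₂ _≈ℂ_ _+ℂ_
    +ℂ-cong (p , q) (r , s) = ℝ.+-cong p r , ℝ.+-cong q s

    *ℂ-cong : Congruent₂ _≈ℂ_ _*ℂ_
    *ℂ-cong (p , q) (r , s) =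
      ℝ.+-cong (ℝ.*-cong p r) (ℝ.-‿cong (ℝ.*-cong q s)) ,
      ℝ.+-cong (ℝ.*-cong p s) (ℝ.*-cong q r)

    *ℂ-comm : Commutative _≈ℂ_ _*ℂ_
    *ℂ-comm (a , b) (c , d) = Laws.*-comm-re a b c d , Laws.*-comm-im a b c d

    *ℂ-identityˡ : LeftIdentity _≈ℂ_ 1ℂ _*ℂ_
    *ℂ-identityˡ (a , b) = Laws.*-identityˡ-re a b , Laws.*-identityˡ-im a b

    *ℂ-distribˡ : _DistributesOverˡ_ _≈ℂ_ _*ℂ_ _+ℂ_
    *ℂ-distribˡ (a , b) (c , d) (e , f) =
      Laws.distribˡ-re a b c d e f , Laws.distribˡ-im a b c d e f

  ℂ-commutativeRing : CommutativeRing ℓ ℓ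
  ℂ-commutativeRing = record
    { Carrier = ℂ
    ; _≈_ = _≈ℂ_
    ; _+_ = _+ℂ_
    ; _*_ = _*ℂ_
    ; -_ = -ℂ_
    ; 0# = 0ℂ
    ; 1# = 1ℂ
    ; isCommutativeRing = record
      { isRing = record
        { +-isAbelianGroup = record
          { isGroup = record
            { isMonoid = record
              { isSemigroup = record
                { isMagma = record { isEquivalence = ×-isEq ; ∙-cong = +ℂ-cong }
                ; assoc = λ (a , b) (c , d) (e , f) → ℝ.+-assoc a c e , ℝ.+-assoc b d f
                }
              ; identity = (λ (a , b) → ℝ.+-identityˡ a , ℝ.+-identityˡ b)
                         , (λ (a , b) → ℝ.+-identityʳ a , ℝ.+-identityʳ b)
              }
            ; inverse = (λ (a , b) → ℝ.-‿inverseˡ a , ℝ.-‿inverseˡ b)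
                      , (λ (a , b) → ℝ.-‿inverseʳ a , ℝ.-‿inverseʳ b)
            ; ⁻¹-cong = λ (p , q) → ℝ.-‿cong p , ℝ.-‿cong q
            }
          ; comm = λ (a , b) (c , d) → ℝ.+-comm a c , ℝ.+-comm b d
          }
        ; *-cong = *ℂ-cong
        ; *-assoc = λ (a , b) (c , d) (e , f) →
            Laws.*-assoc-re a b c d e f , Laws.*-assoc-im a b c d e f
        ; *-identity = comm∧idˡ⇒id ℂ-setoid *ℂ-comm *ℂ-identityˡ
        ; distrib = comm∧distrˡ⇒distr ℂ-setoid +ℂ-cong *ℂ-comm *ℂ-distribˡ
        }
      ; *-comm = *ℂ-comm
      }
    }

record HilbertSpace {ℓ} (ℝ : RealNumbers ℓ) : Set (lsuc ℓ) where
  open Complex ℝ public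
  open RealNumbers ℝ public using (_≤_; _<_; 0#; _*_)

  field
    leftModule : LeftModule (CommutativeRing.ring ℂ-commutativeRing) ℓ ℓ

  open LeftModule leftModule public

  infixl 6 _-ᴹ_

  _-ᴹ_ : Carrierᴹ → Carrierᴹ → Carrierᴹ
  x -ᴹ y = x +ᴹ (-ᴹ y)

  field
    ⟨_,_⟩       : Carrierᴹ → Carrierᴹ → ℂ
    ⟨⟩-cong     : ∀ {x x′ y y′} → x ≈ᴹ x′ → y ≈ᴹ y′ → ⟨ x , y ⟩ ≈ℂ ⟨ x′ , y′ ⟩
    ⟨⟩-+ˡ       : ∀ x y z → ⟨ x +ᴹ y , z ⟩ ≈ℂ ⟨ x , z ⟩ +ℂ ⟨ y , z ⟩
    ⟨⟩-*ˡ       : ∀ a x y → ⟨ a *ₗ x , y ⟩ ≈ℂ a *ℂ ⟨ x , y ⟩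
    ⟨⟩-conj     : ∀ x y → ⟨ y , x ⟩ ≈ℂ conj ⟨ x , y ⟩
    ⟨⟩-nonNeg   : ∀ x → 0# ≤ Re ⟨ x , x ⟩
    ⟨⟩-definite : ∀ x → ⟨ x , x ⟩ ≈ℂ 0ℂ → x ≈ᴹ 0ᴹ

  ‖_‖² : Carrierᴹ → RealNumbers.Carrier ℝ
  ‖ x ‖² = Re ⟨ x , x ⟩

  -- ‖ x - y ‖ < ε, squared.
  Within : RealNumbers.Carrier ℝ → Carrierᴹ → Carrierᴹ → Set ℓ
  Within ε x y = ‖ x -ᴹ y ‖² < ε * ε

  IsCauchy : (ℕ → Carrierᴹ) → Set ℓ
  IsCauchy s = ∀ ε → 0# < ε → ∃[ N ] (∀ m n → N ℕ.≤ m → N ℕ.≤ n → Within ε (s m) (s n))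

  ConvergesTo : (ℕ → Carrierᴹ) → Carrierᴹ → Set ℓ
  ConvergesTo s x = ∀ ε → 0# < ε → ∃[ N ] (∀ n → N ℕ.≤ n → Within ε (s n) x)

  field
    complete : ∀ s → IsCauchy s → ∃[ x ] ConvergesTo s x

-- A graph is given by its vertices, up to the setoid equality, and its adjacency relation.
record Graph c ℓ e : Set (lsuc (c ⊔ ℓ ⊔ e)) where
  field
    vertices : Setoid c ℓ
    Edge     : Rel (Setoid.Carrier vertices) e

  open Setoid vertices public renaming (Carrier to Vertex; _≈_ to _≈ⱽ_) using ()

  -- p is the sequence of vertices of a path with n edges
  IsPath : Vertex → Vertex → ∀ {n} → Vector Vertex (suc n) → Set (ℓ ⊔ e)
  IsPath v w {n} p = p zero ≈ⱽ v × p (fromℕ n) ≈ⱽ w × (∀ (i : Fin n) → Edge (p (inject₁ i)) (p (suc i)))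

  IsDistance : Vertex → Vertex → ℕ → Set (c ⊔ ℓ ⊔ e)
  IsDistance v w d = (∃[ p ] IsPath v w {d} p) × (∀ {n} p → IsPath v w {n} p → d ℕ.≤ n)

  IsGeodesic : Vertex → Vertex → ∀ {n} → Vector Vertex (suc n) → Set (c ⊔ ℓ ⊔ e)
  IsGeodesic v w {n} p = IsPath v w p × IsDistance v w n

module Subspaces {ℓ} {ℝ : RealNumbers ℓ} (H : HilbertSpace ℝ) where
  open HilbertSpace H
  open Sum +ᴹ-commutativeMonoid using (sum)

  record Subspace : Set (lsuc ℓ) where
    field
      member    : Pred Carrierᴹ ℓ
      respects  : ∀ {x y} → x ≈ᴹ y → x ∈ member → y ∈ member
      0-closed  : 0ᴹ ∈ member
      +-closed  : ∀ {x y} → x ∈ member → y ∈ member → x +ᴹ y ∈ member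
      *ₗ-closed : ∀ a {x} → x ∈ member → a *ₗ x ∈ member

  open Subspace public

  linearCombination : ∀ {n} → Vector ℂ n → Vector Carrierᴹ n → Carrierᴹ
  linearCombination a v = sum λ i → a i *ₗ v i

  LinearlyIndependent : ∀ {n} → Vector Carrierᴹ n → Set ℓ
  LinearlyIndependent v = ∀ a → linearCombination a v ≈ᴹ 0ᴹ → ∀ i → a i ≈ℂ 0ℂ

  IsBasisOf : Pred Carrierᴹ ℓ → ∀ {n} → Vector Carrierᴹ n → Set ℓ
  IsBasisOf X v = (∀ i → v i ∈ X) × LinearlyIndependent v ×
                  (∀ x → x ∈ X → ∃[ a ] x ≈ᴹ linearCombination a v)

  HasDimension : Pred Carrierᴹ ℓ → ℕ → Set ℓ
  HasDimension X n = ∃[ v ] IsBasisOf X {n} v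

  -- dim H ≥ n; holds for every n when H is infinite-dimensional.
  DimensionAtLeast : ℕ → Set ℓ
  DimensionAtLeast n = ∃[ v ] LinearlyIndependent {n} v

  Span : Pred Carrierᴹ ℓ → Pred Carrierᴹ ℓ
  Span S x = ∃[ n ] Σ (Vector Carrierᴹ n) λ v → (∀ i → v i ∈ S) × ∃[ a ] x ≈ᴹ linearCombination a v

  ClosedSpan : Pred Carrierᴹ ℓ → Pred Carrierᴹ ℓ
  ClosedSpan S x = ∀ ε → 0# < ε → ∃[ y ] (y ∈ Span S × Within ε x y)

  IsOrthonormalBasis : Pred Carrierᴹ ℓ → Set ℓ
  IsOrthonormalBasis B =
    (∀ x → x ∈ B → ⟨ x , x ⟩ ≈ℂ 1ℂ) ×
    (∀ x y → x ∈ B → y ∈ B → ¬ x ≈ᴹ y → ⟨ x , y ⟩ ≈ℂ 0ℂ) ×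
    (∀ x → x ∈ ClosedSpan B)

  SpannedBySubset : Subspace → Pred Carrierᴹ ℓ → Set (lsuc ℓ)
  SpannedBySubset X B = Σ (Pred Carrierᴹ ℓ) λ S → S ⊆ B × member X ≐ ClosedSpan S

  Compatible : Subspace → Subspace → Set (lsuc ℓ)
  Compatible X Y = ∃[ B ] (IsOrthonormalBasis B × SpannedBySubset X B × SpannedBySubset Y B)

  record Grassmannian (k : ℕ) : Set (lsuc ℓ) where
    field
      subspace  : Subspace
      dimension : HasDimension (member subspace) k

  open Grassmannian public

  grassmannianSetoid : ℕ → Setoid (lsuc ℓ) ℓ
  grassmannianSetoid k =
    On.setoid {B = Grassmannian k} (≐-setoid Carrierᴹ ℓ) (λ X → member (subspace X))

  Adjacent : ∀ {k} → Rel (Grassmannian k) ℓ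
  Adjacent {k} X Y =
    ∃[ j ] (k ≡ suc j × HasDimension (member (subspace X) ∩ member (subspace Y)) j)

  OrthoAdjacent : ∀ {k} → Rel (Grassmannian k) (lsuc ℓ)
  OrthoAdjacent X Y = Adjacent X Y × Compatible (subspace X) (subspace Y)

  GrassmannGraph : ℕ → Graph (lsuc ℓ) ℓ ℓ
  GrassmannGraph k = record { vertices = grassmannianSetoid k ; Edge = Adjacent }

  OrthoGrassmannGraph : ℕ → Graph (lsuc ℓ) ℓ (lsuc ℓ)
  OrthoGrassmannGraph k = record { vertices = grassmannianSetoid k ; Edge = OrthoAdjacent }

{-# OPTIONS --safe #-}
module Submission where

-- Finite-dimensional X and Y are compatible exactly if the parts of X and Y
-- orthogonal to X ∩ Y are orthogonal to each other: orthonormal bases of X ∩ Y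
-- and of these two parts then extend to an orthonormal basis of H, by Zorn's
-- lemma and the projection theorem.
--
-- Along an edge of the Grassmann graph dim (Z ∩ Y) changes by at most one, so
-- the distance from X to Y is k - dim (X ∩ Y), and every edge Z — Z′ of a
-- geodesic towards Y raises dim (Z ∩ Y) by one. If Z and Y are compatible, then
-- Z′ is (Z ∩ Z′) ⊕ ℂv with v ∈ Y orthogonal to Z; hence Z and Z′ are compatible,
-- and so are Z′ and Y, which carries the induction along the geodesic.
--
-- Conversely, if x ∈ X and y ∈ Y are orthogonal to X ∩ Y but not to each other,
-- then X′ = (X ∩ x^⊥) ⊕ ℂy is the second vertex of a geodesic from X to Y, and
-- X and X′ are not compatible.

-- Every ortho-adjacency is an adjacency, so minimality of length passes from the Grassmann graph to
-- the ortho-Grassmann graph, and the theorem is about compatibility of single edges. The converse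
-- looks only at the first edge: if `X` and `X′` were compatible, the part of `y` orthogonal to
-- `X ∩ X′` would be orthogonal to `X`, while the rest of `y` lies in `X ∩ x^⊥`, whence `x ⊥ y`.
--
-- Dimension counts avoid bases: the recursive `Dim` peels off one orthogonal direction at a time,
-- and `exchange` allows any nonzero vector to be peeled off first, so that counting becomes a
-- comparison of sections `V ∩ w^⊥`.
--
-- The analysis is forced by the definition of compatibility, which asks for an orthonormal basis of
-- all of `H`. Maximality of an orthonormal set only makes its orthogonal complement trivial; that
-- its closed span is `H` is where completeness enters, through estimates derived from the order
-- axioms of the reals.

open import Defs
open import Algebra.Bundles using (CommutativeRing; CommutativeMonoid; RawRing)
import Algebra.Properties.AbelianGroup as AbelianGroupProperties
import Algebra.Properties.CommutativeSemigroup as CommutativeSemigroupProperties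
import Algebra.Properties.Ring as RingProperties
import Algebra.Properties.Semiring.Mult as SemiringMult
import Algebra.Solver.Ring as RingSolver
open import Algebra.Solver.Ring.AlmostCommutativeRing using (fromCommutativeRing; _-Raw-AlmostCommutative⟶_)
import Algebra.Solver.Ring.NaturalCoefficients.Default as NaturalCoefficients
open import Axiom.ExcludedMiddle using (ExcludedMiddle)
open import Data.Empty using (⊥-elim)
open import Data.Empty.Polymorphic using () renaming (⊥ to ⊥ᵖ)
open import Data.Fin using (Fin; zero; suc; inject₁; fromℕ)
open import Data.Maybe using (Maybe; just; nothing)
import Data.Nat as ℕ
open import Data.Nat using (ℕ; zero; suc)
import Data.Nat.Properties as ℕ
open import Data.Product using (∃-syntax; _×_; _,_; proj₁; proj₂)
open import Data.Sum using (_⊎_; inj₁; inj₂; [_,_]′)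
open import Data.Vec.Functional using (Vector; _∷_)
open import Function using (_∘_; id)
open import Function.Bundles using (_⇔_; mk⇔)
open import Level using (Lift; lift; lower) renaming (suc to lsuc)
open import Relation.Binary using (IsTotalOrder; Poset)
open import Relation.Binary.PropositionalEquality as ≡ using (_≡_)
import Relation.Binary.Reasoning.Setoid as SetoidReasoning
open import Relation.Nullary using (¬_; yes; no; contradiction)
open import Relation.Nullary.Decidable using (decidable-stable; True; toWitness; fromWitness)
open import Relation.Unary using (Pred; _∈_; _⊆_; _≐_; _∩_; _∪_)
open import Relation.Unary.Properties using (≐-refl; ≐-sym; ≐-trans)

-- Integer coefficients for the ring solver

-- The pair (a , b) stands for the integer a - b. Integer coefficients let the
-- ring solver cancel in a ring without decidable equality.
module DifferenceSolver {r ℓ} (R : CommutativeRing r ℓ) where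
  private
    open CommutativeRing R
    open RingProperties ring using (-1*x≈-x; -0#≈0#; -‿involutive)
    open SemiringMult semiring using (×-homo-+; ×1-homo-*) renaming (_×_ to _·_)
    open SetoidReasoning setoid
    open NaturalCoefficients commutativeSemiring using (solve; _:+_; _:*_; _:=_)

    -- Keeping one component zero makes equal coefficients syntactically equal,
    -- so that the normal forms compared by the solver agree.
    normalise : ℕ × ℕ → ℕ × ℕ
    normalise (a , b) = a ℕ.∸ b , b ℕ.∸ a

    differences : RawRing _ _
    differences = record
      { Carrier = ℕ × ℕ
      ; _≈_ = _≡_
      ; _+_ = λ (a , b) (c , d) → normalise (a ℕ.+ c , b ℕ.+ d)
      ; _*_ = λ (a , b) (c , d) → normalise (a ℕ.* c ℕ.+ b ℕ.* d , a ℕ.* d ℕ.+ b ℕ.* c)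
      ; -_ = λ (a , b) → b , a
      ; 0# = 0 , 0
      ; 1# = 1 , 0
      }

    nat : ℕ → Carrier
    nat n = n · 1#

    ⟦_⟧ : ℕ × ℕ → Carrier
    ⟦ a , b ⟧ = nat a - nat b

    minus : ∀ x y → x - y ≈ x + - 1# * y
    minus x y = +-congˡ (sym (-1*x≈-x y))

    nat-+ : ∀ a b → nat (a ℕ.+ b) ≈ nat a + nat b
    nat-+ = ×-homo-+ 1#

    -1*-1≈1 : - 1# * - 1# ≈ 1#
    -1*-1≈1 = trans (-1*x≈-x (- 1#)) (-‿involutive 1#)

    ⟦⟧-cong : ∀ a b c d → a ℕ.+ d ≡ c ℕ.+ b → ⟦ a , b ⟧ ≈ ⟦ c , d ⟧
    ⟦⟧-cong a b c d p = begin
      nat a - nat b                          ≈⟨ +-congʳ (sym (+-identityʳ _)) ⟩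
      nat a + 0# - nat b                     ≈⟨ +-congʳ (+-congˡ (sym (-‿inverseʳ (nat d)))) ⟩
      nat a + (nat d - nat d) - nat b        ≈⟨ regroup (nat a) (nat d) (- nat d) (- nat b) ⟩
      (nat a + nat d) + (- nat d - nat b)    ≈⟨ +-congʳ (nat-+ a d) ⟨
      nat (a ℕ.+ d) + (- nat d - nat b)      ≈⟨ +-congʳ (reflexive (≡.cong nat p)) ⟩
      nat (c ℕ.+ b) + (- nat d - nat b)      ≈⟨ +-congʳ (nat-+ c b) ⟩
      (nat c + nat b) + (- nat d - nat b)    ≈⟨ regroup′ (nat c) (nat b) (- nat d) (- nat b) ⟩
      nat c + (nat b - nat b) - nat d        ≈⟨ +-congʳ (+-congˡ (-‿inverseʳ (nat b))) ⟩
      nat c + 0# - nat d                     ≈⟨ +-congʳ (+-identityʳ _) ⟩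
      nat c - nat d                          ∎
      where
      regroup = solve 4 (λ a b c d → a :+ (b :+ c) :+ d := (a :+ b) :+ (c :+ d)) refl
      regroup′ = solve 4 (λ a b c d → (a :+ b) :+ (c :+ d) := a :+ (b :+ d) :+ c) refl

    normalise-≈ : ∀ x → ⟦ normalise x ⟧ ≈ ⟦ x ⟧
    normalise-≈ (a , b) = ⟦⟧-cong (a ℕ.∸ b) (b ℕ.∸ a) a b (maximum a b)
      where
      maximum : ∀ a b → a ℕ.∸ b ℕ.+ b ≡ a ℕ.+ (b ℕ.∸ a)
      maximum a       zero    = ≡.cong₂ ℕ._+_ ≡.refl (≡.sym (ℕ.0∸n≡0 a))
      maximum zero    (suc b) = ≡.refl
      maximum (suc a) (suc b) = ≡.trans (ℕ.+-suc (a ℕ.∸ b) b) (≡.cong suc (maximum a b))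

    +-homo : ∀ x y → ⟦ RawRing._+_ differences x y ⟧ ≈ ⟦ x ⟧ + ⟦ y ⟧
    +-homo (a , b) (c , d) = begin
      ⟦ normalise (a ℕ.+ c , b ℕ.+ d) ⟧                ≈⟨ normalise-≈ (a ℕ.+ c , b ℕ.+ d) ⟩
      nat (a ℕ.+ c) - nat (b ℕ.+ d)                    ≈⟨ +-cong (nat-+ a c) (-‿cong (nat-+ b d)) ⟩
      (nat a + nat c) - (nat b + nat d)                ≈⟨ minus _ _ ⟩
      (nat a + nat c) + - 1# * (nat b + nat d)
        ≈⟨ solve 5 (λ m a b c d → (a :+ c) :+ m :* (b :+ d) := (a :+ m :* b) :+ (c :+ m :* d)) refl
             (- 1#) (nat a) (nat b) (nat c) (nat d) ⟩
      (nat a + - 1# * nat b) + (nat c + - 1# * nat d)  ≈⟨ +-cong (minus _ _) (minus _ _) ⟨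
      ⟦ a , b ⟧ + ⟦ c , d ⟧                            ∎

    nat-*+* : ∀ a b c d → nat (a ℕ.* b ℕ.+ c ℕ.* d) ≈ nat a * nat b + nat c * nat d
    nat-*+* a b c d = trans (nat-+ (a ℕ.* b) (c ℕ.* d)) (+-cong (×1-homo-* a b) (×1-homo-* c d))

    *-homo : ∀ x y → ⟦ RawRing._*_ differences x y ⟧ ≈ ⟦ x ⟧ * ⟦ y ⟧
    *-homo (a , b) (c , d) = begin
      ⟦ normalise (a ℕ.* c ℕ.+ b ℕ.* d , a ℕ.* d ℕ.+ b ℕ.* c) ⟧
        ≈⟨ normalise-≈ (a ℕ.* c ℕ.+ b ℕ.* d , a ℕ.* d ℕ.+ b ℕ.* c) ⟩
      ⟦ a ℕ.* c ℕ.+ b ℕ.* d , a ℕ.* d ℕ.+ b ℕ.* c ⟧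
        ≈⟨ +-cong (nat-*+* a c b d) (-‿cong (nat-*+* a d b c)) ⟩
      (nat a * nat c + nat b * nat d) - (nat a * nat d + nat b * nat c)
        ≈⟨ minus _ _ ⟩
      (nat a * nat c + nat b * nat d) + - 1# * (nat a * nat d + nat b * nat c)
        -- The solver treats `- 1#` as an arbitrary `m`; that its square is `1#` has to be put in by
        -- hand.
        ≈⟨ +-congʳ (+-congˡ (trans (*-congʳ -1*-1≈1) (*-identityˡ _))) ⟨
      (nat a * nat c + (- 1# * - 1#) * (nat b * nat d)) + - 1# * (nat a * nat d + nat b * nat c)
        ≈⟨ solve 5 (λ m a b c d → (a :* c :+ (m :* m) :* (b :* d)) :+ m :* (a :* d :+ b :* c)
             := (a :+ m :* b) :* (c :+ m :* d)) refl (- 1#) (nat a) (nat b) (nat c) (nat d) ⟩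
      (nat a + - 1# * nat b) * (nat c + - 1# * nat d)
        ≈⟨ *-cong (minus _ _) (minus _ _) ⟨
      ⟦ a , b ⟧ * ⟦ c , d ⟧ ∎

    -‿homo : ∀ x → ⟦ RawRing.-_ differences x ⟧ ≈ - ⟦ x ⟧
    -‿homo (a , b) = sym (⁻¹-anti-homo‿- (nat a) (nat b))
      where open import Algebra.Properties.AbelianGroup +-abelianGroup using (⁻¹-anti-homo‿-)

    morphism : differences -Raw-AlmostCommutative⟶ fromCommutativeRing R
    morphism = record
      { ⟦_⟧ = ⟦_⟧
      ; +-homo = +-homo
      ; *-homo = *-homo
      ; -‿homo = -‿homo
      ; 0-homo = -‿inverseʳ 0#
      ; 1-homo = trans (+-cong (+-identityʳ 1#) -0#≈0#) (+-identityʳ 1#)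
      }

    equal : ∀ x y → Maybe (⟦ x ⟧ ≈ ⟦ y ⟧)
    equal (a , b) (c , d) with a ℕ.+ d ℕ.≟ c ℕ.+ b
    ... | yes p = just (⟦⟧-cong a b c d p)
    ... | no _  = nothing

  open RingSolver differences (fromCommutativeRing R) morphism equal public
    using (solve; con; _:+_; _:*_; _:-_; :-_; _:=_)

-- Ordered field arithmetic, Archimedean property, square roots

module RealProperties {ℓ} (em : ExcludedMiddle ℓ) (ℝ : RealNumbers ℓ) where
  open RealNumbers ℝ
  open IsTotalOrder isTotalOrder public using (total; antisym) renaming
    (refl to ≤-refl; trans to ≤-trans; reflexive to ≤-reflexive; ≲-respʳ-≈ to ≤-respʳ-≈; ≲-respˡ-≈ to ≤-respˡ-≈)
  open DifferenceSolver commutativeRing public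
  open SetoidReasoning setoid
  open SemiringMult semiring using () renaming (_×_ to _·_)

  ≤⇒0≤- : ∀ {x y} → x ≤ y → 0# ≤ y - x
  ≤⇒0≤- {x} p = ≤-respˡ-≈ (-‿inverseʳ x) (+-monoˡ-≤ (- x) p)

  0≤-⇒≤ : ∀ {x y} → 0# ≤ y - x → x ≤ y
  0≤-⇒≤ {x} {y} p = ≤-respˡ-≈ (+-identityˡ x)
    (≤-respʳ-≈ (solve 2 (λ x y → y :- x :+ x := y) refl x y) (+-monoˡ-≤ x p))

  ≤-by : ∀ {x y e} → 0# ≤ e → y - x ≈ e → x ≤ y
  ≤-by p q = 0≤-⇒≤ (≤-respʳ-≈ (sym q) p)

  +-mono-≤ : ∀ {x y u v} → x ≤ y → u ≤ v → x + u ≤ y + v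
  +-mono-≤ {x} {y} {u} {v} p q = ≤-trans (+-monoˡ-≤ u p)
    (≤-respˡ-≈ (+-comm u y) (≤-respʳ-≈ (+-comm v y) (+-monoˡ-≤ y q)))

  +-nonNeg : ∀ {x y} → 0# ≤ x → 0# ≤ y → 0# ≤ x + y
  +-nonNeg p q = ≤-respˡ-≈ (+-identityˡ 0#) (+-mono-≤ p q)

  *-monoʳ-≤ : ∀ {x y z} → 0# ≤ z → x ≤ y → z * x ≤ z * y
  *-monoʳ-≤ {x} {y} {z} p q = ≤-by (*-nonNeg p (≤⇒0≤- q))
    (solve 3 (λ x y z → z :* y :- z :* x := z :* (y :- x)) refl x y z)

  neg-nonNeg : ∀ {x} → x ≤ 0# → 0# ≤ - x
  neg-nonNeg {x} p = ≤-respʳ-≈ (+-identityˡ (- x)) (≤⇒0≤- p)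

  square-nonNeg : ∀ x → 0# ≤ x * x
  square-nonNeg x with total 0# x
  ... | inj₁ p = *-nonNeg p p
  ... | inj₂ p = ≤-respʳ-≈ (solve 1 (λ x → :- x :* :- x := x :* x) refl x)
                   (*-nonNeg (neg-nonNeg p) (neg-nonNeg p))

  0≤1 : 0# ≤ 1#
  0≤1 = ≤-respʳ-≈ (*-identityˡ 1#) (square-nonNeg 1#)

  0<1 : 0# < 1#
  0<1 = 0≤1 , 0≉1

  ≰⇒> : ∀ {x y} → ¬ x ≤ y → y < x
  ≰⇒> {x} {y} p with total x y
  ... | inj₁ q = contradiction q p
  ... | inj₂ q = q , λ e → p (≤-reflexive (sym e))

  <⇒≱ : ∀ {x y} → x < y → ¬ y ≤ x
  <⇒≱ (p , n) q = n (antisym p q)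

  ≮⇒≥ : ∀ {x y} → ¬ x < y → y ≤ x
  ≮⇒≥ {x} {y} n with em {y ≤ x}
  ... | yes p = p
  ... | no q  = contradiction (≰⇒> q) n

  <-respʳ-≈ : ∀ {x y z} → y ≈ z → x < y → x < z
  <-respʳ-≈ e (p , n) = ≤-respʳ-≈ e p , λ q → n (trans q (sym e))

  <-≤-trans : ∀ {x y z} → x < y → y ≤ z → x < z
  <-≤-trans (p , n) q = ≤-trans p q , λ e → n (antisym p (≤-respʳ-≈ (sym e) q))

  ≤-<-trans : ∀ {x y z} → x ≤ y → y < z → x < z
  ≤-<-trans p (q , n) = ≤-trans p q , λ e → n (antisym q (≤-respˡ-≈ e p))

  <⇒0<- : ∀ {x y} → x < y → 0# < y - x
  <⇒0<- {x} {y} (p , n) = ≤⇒0≤- p , λ e → n (begin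
    x            ≈⟨ +-identityˡ x ⟨
    0# + x       ≈⟨ +-congʳ e ⟩
    y - x + x    ≈⟨ solve 2 (λ x y → y :- x :+ x := y) refl x y ⟩
    y            ∎)

  0<-⇒< : ∀ {x y} → 0# < y - x → x < y
  0<-⇒< {x} (p , n) = 0≤-⇒≤ p , λ e → n (trans (sym (-‿inverseʳ x)) (+-congʳ e))

  <-by : ∀ {x y e} → 0# < e → y - x ≈ e → x < y
  <-by p q = 0<-⇒< (<-respʳ-≈ (sym q) p)

  +-pos : ∀ {x y} → 0# < x → 0# ≤ y → 0# < x + y
  +-pos {x} {y} p q = <-≤-trans p (≤-by q (solve 2 (λ x y → x :+ y :- x := y) refl x y))

  private
    pos-inverse′ : ∀ {x} → 0# < x → ∃[ y ] (0# < y × x * y ≈ 1#)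
    pos-inverse′ {x} (p , n) with inverse x (λ e → n (sym e))
    ... | y , xy≈1 = y , ≰⇒> y≰0 , xy≈1
      where
      y≰0 : ¬ y ≤ 0#
      y≰0 q = <⇒≱ 0<1 (≤-by (*-nonNeg p (neg-nonNeg q)) (begin
        0# - 1#    ≈⟨ +-identityˡ _ ⟩
        - 1#       ≈⟨ -‿cong xy≈1 ⟨
        - (x * y)  ≈⟨ solve 2 (λ x y → :- (x :* y) := x :* :- y) refl x y ⟩
        x * - y    ∎))

  -- Abstract (like ℂ-inverse, 1/ and sqrt), because unfolding the ring-solver proofs in it is infeasible.
  abstract
    pos-inverse : ∀ {x} → 0# < x → ∃[ y ] (0# < y × x * y ≈ 1#)
    pos-inverse = pos-inverse′

  *-cancelˡ-≤ : ∀ {x y z} → 0# < x → x * y ≤ x * z → y ≤ z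
  *-cancelˡ-≤ {x} {y} {z} p q = ≤-respˡ-≈ (cancel y) (≤-respʳ-≈ (cancel z) (*-monoʳ-≤ (proj₁ 0<i) q))
    where
    i = proj₁ (pos-inverse p)
    0<i = proj₁ (proj₂ (pos-inverse p))
    xi≈1 : x * i ≈ 1#
    xi≈1 = proj₂ (proj₂ (pos-inverse p))
    cancel : ∀ u → i * (x * u) ≈ u
    cancel u = begin
      i * (x * u)  ≈⟨ solve 3 (λ i x u → i :* (x :* u) := (x :* i) :* u) refl i x u ⟩
      (x * i) * u  ≈⟨ *-congʳ xi≈1 ⟩
      1# * u       ≈⟨ *-identityˡ u ⟩
      u            ∎

  *-pos : ∀ {x y} → 0# < x → 0# < y → 0# < x * y
  *-pos {x} {y} p q = ≰⇒> λ r →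
    <⇒≱ q (*-cancelˡ-≤ p (≤-respʳ-≈ (sym (zeroʳ x)) r))

  square-cancel-≤ : ∀ {x y} → 0# ≤ y → x * x ≤ y * y → x ≤ y
  square-cancel-≤ {x} {y} 0≤y p = ≮⇒≥ λ y<x →
    <⇒≱ (<-by (*-pos (<⇒0<- y<x) (<-respʳ-≈ (+-comm x y) (+-pos (≤-<-trans 0≤y y<x) 0≤y)))
              (solve 2 (λ x y → x :* x :- y :* y := (x :- y) :* (y :+ x)) refl x y)) p

  square-zero : ∀ {x} → x * x ≤ 0# → x ≈ 0#
  square-zero {x} p = antisym (square-cancel-≤ ≤-refl (≤-respʳ-≈ (sym (zeroˡ 0#)) p))
    (≤-respʳ-≈ (solve 1 (λ x → :- :- x := x) refl x) (neg-nonNeg -x≤0))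
    where
    -x≤0 : - x ≤ 0#
    -x≤0 = square-cancel-≤ ≤-refl
      (≤-respˡ-≈ (solve 1 (λ x → x :* x := :- x :* :- x) refl x) (≤-respʳ-≈ (sym (zeroˡ 0#)) p))

  ≤-from-ε : ∀ {x} → (∀ ε → 0# < ε → x ≤ ε) → x ≤ 0#
  ≤-from-ε {x} f = ≮⇒≥ λ 0<x →
    -- `h` is one half: a positive `x` is not below `h * x`, the ε used here.
    let (h , 0<h , 2h≈1) = pos-inverse (+-pos 0<1 0≤1)
        hx<x : h * x < x
        hx<x = <-by (*-pos 0<h 0<x) (begin
          x - h * x                   ≈⟨ +-congʳ (trans (sym (*-identityˡ x)) (*-congʳ (sym 2h≈1))) ⟩
          (1# + 1#) * h * x - h * x   ≈⟨ +-congʳ (*-congʳ (trans (distribʳ h 1# 1#) (+-cong (*-identityˡ h) (*-identityˡ h)))) ⟩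
          (h + h) * x - h * x         ≈⟨ solve 2 (λ h x → (h :+ h) :* x :- h :* x := h :* x) refl h x ⟩
          h * x                       ∎)
    in <⇒≱ hx<x (f (h * x) (*-pos 0<h 0<x))

  -- Were `x` above every natural number, the reals lying below some natural number would have a
  -- supremum `s`; they are stable under adding `1#`, so `s - 1#` would bound them too.
  archimedean : ∀ x → ∃[ n ] x ≤ n · 1#
  archimedean x with em {∃[ n ] x ≤ n · 1#}
  ... | yes p = p
  ... | no ¬p = ⊥-elim (above-s (λ y (n , y≤n) →
      ≤-by (≤⇒0≤- (upper _ (suc n , ≤-respʳ-≈ (+-comm (n · 1#) 1#) (+-monoˡ-≤ 1# y≤n))))
        (solve 3 (λ s y o → s :- o :- y := s :- (y :+ o)) refl s y 1#)))
    where
    S : Pred Carrier ℓ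
    S y = ∃[ n ] y ≤ n · 1#
    sup = supremum S (0# , 0 , ≤-refl)
      (x , λ y (n , y≤n) → ≤-trans y≤n (proj₁ (≰⇒> (λ x≤n → ¬p (n , x≤n)))))
    s = proj₁ sup
    upper : IsUpperBound S s
    upper = proj₁ (proj₂ sup)
    above-s : ¬ IsUpperBound S (s - 1#)
    above-s u = <⇒≱ (<-by 0<1 (solve 2 (λ s o → s :- (s :- o) := o) refl s 1#))
      (proj₂ (proj₂ sup) (s - 1#) u)

  nat-nonNeg : ∀ n → 0# ≤ n · 1#
  nat-nonNeg zero    = ≤-refl
  nat-nonNeg (suc n) = +-nonNeg 0≤1 (nat-nonNeg n)

  nat-mono : ∀ {m n} → m ℕ.≤ n → m · 1# ≤ n · 1#
  nat-mono {n = n} ℕ.z≤n = nat-nonNeg n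
  nat-mono (ℕ.s≤s p) = +-mono-≤ ≤-refl (nat-mono p)

  abstract
    1/ : ℕ → Carrier
    1/ n = proj₁ (pos-inverse (+-pos 0<1 (nat-nonNeg n)))

    1/-pos : ∀ n → 0# < 1/ n
    1/-pos n = proj₁ (proj₂ (pos-inverse (+-pos 0<1 (nat-nonNeg n))))

    1/-inverse : ∀ n → suc n · 1# * 1/ n ≈ 1#
    1/-inverse n = proj₂ (proj₂ (pos-inverse (+-pos 0<1 (nat-nonNeg n))))

  1/-small : ∀ ε → 0# < ε → ∃[ N ] (∀ n → N ℕ.≤ n → 1/ n ≤ ε)
  1/-small ε 0<ε =
    let (i , 0<i , εi≈1) = pos-inverse 0<ε
        (N , i≤N) = archimedean i
    in N , λ n N≤n → *-cancelˡ-≤ (+-pos 0<1 (nat-nonNeg n))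
      (≤-respˡ-≈ (trans εi≈1 (sym (1/-inverse n)))
        (≤-respʳ-≈ (*-comm ε _)
          (*-monoʳ-≤ (proj₁ 0<ε) (≤-trans i≤N (nat-mono (ℕ.m≤n⇒m≤1+n N≤n))))))

  private
    sqrt′ : ∀ a → 0# ≤ a → ∃[ s ] (0# ≤ s × s * s ≈ a)
    sqrt′ a 0≤a = s , 0≤s , antisym s²≤a a≤s²
      where
      S : Pred Carrier ℓ
      S t = t * t ≤ a
      bound : IsUpperBound S (a + 1#)
      bound t t²≤a = square-cancel-≤ (+-nonNeg 0≤a 0≤1)
        (≤-trans t²≤a (≤-by (+-nonNeg (+-nonNeg (square-nonNeg a) 0≤a) (square-nonNeg 1#))
          (begin
            (a + 1#) * (a + 1#) - a
              ≈⟨ solve 2 (λ a o → (a :+ o) :* (a :+ o) :- a := a :* a :+ (a :* o :+ a :* o :- a) :+ o :* o) refl a 1# ⟩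
            a * a + (a * 1# + a * 1# - a) + 1# * 1#
              ≈⟨ +-congʳ (+-congˡ (+-congʳ (+-cong (*-identityʳ a) (*-identityʳ a)))) ⟩
            a * a + (a + a - a) + 1# * 1#
              ≈⟨ solve 2 (λ a o → a :* a :+ (a :+ a :- a) :+ o :* o := a :* a :+ a :+ o :* o) refl a 1# ⟩
            a * a + a + 1# * 1# ∎)))
      sup = supremum S (0# , ≤-respˡ-≈ (sym (zeroˡ 0#)) 0≤a) (a + 1# , bound)
      s = proj₁ sup
      upper : IsUpperBound S s
      upper = proj₁ (proj₂ sup)
      least = proj₂ (proj₂ sup)
      0≤s : 0# ≤ s
      0≤s = upper 0# (≤-respˡ-≈ (sym (zeroˡ 0#)) 0≤a)
      a≤s² : a ≤ s * s
      a≤s² = ≮⇒≥ λ s²<a →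
        let e = a - s * s
            0<e = <⇒0<- s²<a
            -- h = e / d is at most 1, whence (s + h)² ≤ s² + d h = a.
            d = 1# + (s + s + e)
            (i , 0<i , di≈1) = pos-inverse (+-pos 0<1 (+-nonNeg (+-nonNeg 0≤s 0≤s) (proj₁ 0<e)))
            h = e * i
            0<h = *-pos 0<e 0<i
            dh≈e : d * h ≈ e
            dh≈e = trans (solve 3 (λ d e i → d :* (e :* i) := e :* (d :* i)) refl d e i)
                     (trans (*-congˡ di≈1) (*-identityʳ e))
            0≤1-h : 0# ≤ 1# - h
            0≤1-h = ≤-respʳ-≈
              (trans (solve 3 (λ o i f → i :* f := (o :+ f) :* i :- o :* i) refl e i (1# + (s + s)))
                (+-congʳ (trans (*-congʳ (solve 3 (λ e o s → e :+ (o :+ (s :+ s)) := o :+ (s :+ s :+ e)) refl e 1# s)) di≈1)))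
              (*-nonNeg (proj₁ 0<i) (+-nonNeg 0≤1 (+-nonNeg 0≤s 0≤s)))
            h-le : (s + h) * (s + h) ≤ a
            h-le = ≤-by (+-nonNeg (*-nonNeg (proj₁ 0<h) 0≤1-h) (*-nonNeg (proj₁ 0<e) (proj₁ 0<h)))
              (begin
                a - (s + h) * (s + h)
                  ≈⟨ solve 3 (λ a s h → a :- (s :+ h) :* (s :+ h) := (a :- s :* s) :- (s :+ s) :* h :- h :* h) refl a s h ⟩
                e - (s + s) * h - h * h
                  ≈⟨ +-congʳ (+-congʳ (sym dh≈e)) ⟩
                d * h - (s + s) * h - h * h
                  ≈⟨ solve 4 (λ o s e h → (o :+ (s :+ s :+ e)) :* h :- (s :+ s) :* h :- h :* h := h :* (o :- h) :+ e :* h) refl 1# s e h ⟩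
                h * (1# - h) + e * h ∎)
        in <⇒≱ (<-by 0<h (solve 2 (λ s h → s :+ h :- s := h) refl s h)) (upper (s + h) h-le)
      s²≤a : s * s ≤ a
      s²≤a = ≮⇒≥ λ a<s² →
        let 0<e = <⇒0<- a<s²
            e = s * s - a
            0<s : 0# < s
            0<s = 0≤s , λ 0≈s → <⇒≱ a<s² (≤-respˡ-≈ (trans (sym (zeroˡ 0#)) (*-cong 0≈s 0≈s)) 0≤a)
            -- s - h is the Newton iterate (s + a / s) / 2.
            (i , 0<i , 2si≈1) = pos-inverse (+-pos 0<s 0≤s)
            h = e * i
            0<h = *-pos 0<e 0<i
            2sh≈e : (s + s) * h ≈ e
            2sh≈e = trans (solve 3 (λ d e i → d :* (e :* i) := e :* (d :* i)) refl (s + s) e i)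
                     (trans (*-congˡ 2si≈1) (*-identityʳ e))
            0≤s-h : 0# ≤ s - h
            0≤s-h = *-cancelˡ-≤ (+-pos 0<s 0≤s) (≤-respˡ-≈ (sym (zeroʳ _))
              (≤-respʳ-≈ (begin
                s * s + a                     ≈⟨ solve 2 (λ s a → s :* s :+ a := (s :+ s) :* s :- (s :* s :- a)) refl s a ⟩
                (s + s) * s - e               ≈⟨ +-congˡ (-‿cong 2sh≈e) ⟨
                (s + s) * s - (s + s) * h     ≈⟨ solve 2 (λ s h → (s :+ s) :* s :- (s :+ s) :* h := (s :+ s) :* (s :- h)) refl s h ⟩
                (s + s) * (s - h)             ∎) (+-nonNeg (square-nonNeg s) 0≤a)))
            a≤[s-h]² : a ≤ (s - h) * (s - h)
            a≤[s-h]² = ≤-by (square-nonNeg h) (begin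
              (s - h) * (s - h) - a
                ≈⟨ solve 3 (λ a s h → (s :- h) :* (s :- h) :- a := (s :* s :- a) :- (s :+ s) :* h :+ h :* h) refl a s h ⟩
              e - (s + s) * h + h * h  ≈⟨ +-congʳ (+-congˡ (-‿cong 2sh≈e)) ⟩
              e - e + h * h            ≈⟨ solve 2 (λ e h → e :- e :+ h :* h := h :* h) refl e h ⟩
              h * h                    ∎)
        in <⇒≱ (<-by 0<h (solve 2 (λ s h → s :- (s :- h) := h) refl s h))
             (least (s - h) (λ t t²≤a → square-cancel-≤ 0≤s-h (≤-trans t²≤a a≤[s-h]²)))

  abstract
    sqrt : ∀ a → 0# ≤ a → ∃[ s ] (0# ≤ s × s * s ≈ a)
    sqrt = sqrt′

-- Subspaces and orthogonality

module Orthogonality {ℓ} (em : ExcludedMiddle ℓ) {ℝ : RealNumbers ℓ} (H : HilbertSpace ℝ) where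
  open HilbertSpace H
  open Subspaces H
  private
    module ℝ where
      open RealNumbers ℝ public
      open RealProperties em ℝ public
    module ℂ = CommutativeRing ℂ-commutativeRing
  open AbelianGroupProperties +ᴹ-abelianGroup using () renaming (inverseʳ-unique to inverseʳ-uniqueᴹ)
  open CommutativeSemigroupProperties (CommutativeMonoid.commutativeSemigroup +ᴹ-commutativeMonoid) public
    using () renaming (interchange to +ᴹ-interchange)

  abstract
    ℂ-inverse : ∀ c → ¬ c ≈ℂ 0ℂ → ∃[ d ] c *ℂ d ≈ℂ 1ℂ
    ℂ-inverse (a , b) c≉0 =
      let (i , ni≈1) = ℝ.inverse (a * a + b * b) n≉0
      in (a * i , ℝ.- (b * i)) ,
         ℝ.trans (solve 3 (λ a b i → a :* (a :* i) :- b :* :- (b :* i) := (a :* a :+ b :* b) :* i) ℝ.refl a b i) ni≈1 ,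
         ℝ.trans (solve 3 (λ a b i → a :* :- (b :* i) :+ b :* (a :* i) := con (0 , 0)) ℝ.refl a b i) (ℝ.-‿inverseʳ ℝ.0#)
      where
      open ℝ using (solve; _:+_; _:*_; _:-_; :-_; _:=_; con; _+_)
      n≉0 : ¬ a * a + b * b ℝ.≈ 0#
      n≉0 n≈0 = c≉0
        ( ℝ.square-zero (ℝ.≤-respʳ-≈ n≈0 (ℝ.≤-by (ℝ.square-nonNeg b)
            (solve 2 (λ a b → a :* a :+ b :* b :- a :* a := b :* b) ℝ.refl a b)))
        , ℝ.square-zero (ℝ.≤-respʳ-≈ n≈0 (ℝ.≤-by (ℝ.square-nonNeg a)
            (solve 2 (λ a b → a :* a :+ b :* b :- b :* b := a :* a) ℝ.refl a b))))

  1≉0 : ¬ 1ℂ ≈ℂ 0ℂ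
  1≉0 (p , _) = ℝ.0≉1 (ℝ.sym p)

  *ₗ-cancel : ∀ {c u} → c *ₗ u ≈ᴹ 0ᴹ → ¬ u ≈ᴹ 0ᴹ → c ≈ℂ 0ℂ
  *ₗ-cancel {c} {u} p u≉0 with em {c ≈ℂ 0ℂ}
  ... | yes q  = q
  ... | no c≉0 = ⊥-elim (u≉0 (begin
    u                      ≈⟨ *ₗ-identityˡ u ⟨
    1ℂ *ₗ u                ≈⟨ *ₗ-congʳ cd≈1 ⟨
    (c *ℂ d) *ₗ u          ≈⟨ *ₗ-congʳ (ℂ.*-comm c d) ⟩
    (d *ℂ c) *ₗ u          ≈⟨ *ₗ-assoc d c u ⟩
    d *ₗ c *ₗ u            ≈⟨ *ₗ-congˡ p ⟩
    d *ₗ 0ᴹ                ≈⟨ *ₗ-zeroʳ d ⟩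
    0ᴹ                     ∎))
    where
    open SetoidReasoning ≈ᴹ-setoid
    d = proj₁ (ℂ-inverse c c≉0)
    cd≈1 = proj₂ (ℂ-inverse c c≉0)

  multiple-sym : ∀ {b u w} → ¬ u ≈ᴹ 0ᴹ → u ≈ᴹ b *ₗ w → ∃[ d ] w ≈ᴹ d *ₗ u
  multiple-sym {b} {u} {w} u≉0 u≈bw = d , (begin
    w                      ≈⟨ *ₗ-identityˡ w ⟨
    1ℂ *ₗ w                ≈⟨ *ₗ-congʳ bd≈1 ⟨
    (b *ℂ d) *ₗ w          ≈⟨ *ₗ-congʳ (ℂ.*-comm b d) ⟩
    (d *ℂ b) *ₗ w          ≈⟨ *ₗ-assoc d b w ⟩
    d *ₗ b *ₗ w            ≈⟨ *ₗ-congˡ u≈bw ⟨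
    d *ₗ u                 ∎)
    where
    open SetoidReasoning ≈ᴹ-setoid
    b≉0 : ¬ b ≈ℂ 0ℂ
    b≉0 b≈0 = u≉0 (≈ᴹ-trans u≈bw (≈ᴹ-trans (*ₗ-congʳ b≈0) (*ₗ-zeroˡ w)))
    d = proj₁ (ℂ-inverse b b≉0)
    bd≈1 = proj₂ (ℂ-inverse b b≉0)

  -1*ₗx≈-x : ∀ x → (ℂ.- 1ℂ) *ₗ x ≈ᴹ -ᴹ x
  -1*ₗx≈-x x = inverseʳ-uniqueᴹ x _ (begin
    x +ᴹ (ℂ.- 1ℂ) *ₗ x          ≈⟨ +ᴹ-congʳ (*ₗ-identityˡ x) ⟨
    1ℂ *ₗ x +ᴹ (ℂ.- 1ℂ) *ₗ x    ≈⟨ *ₗ-distribʳ x 1ℂ (ℂ.- 1ℂ) ⟨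
    (1ℂ ℂ.- 1ℂ) *ₗ x            ≈⟨ *ₗ-congʳ (ℂ.-‿inverseʳ 1ℂ) ⟩
    0ℂ *ₗ x                     ≈⟨ *ₗ-zeroˡ x ⟩
    0ᴹ                          ∎)
    where open SetoidReasoning ≈ᴹ-setoid

  infix 4 _⊥_

  _⊥_ : Carrierᴹ → Carrierᴹ → Set ℓ
  x ⊥ y = ⟨ x , y ⟩ ≈ℂ 0ℂ

  ⊥-sym : ∀ {x y} → x ⊥ y → y ⊥ x
  ⊥-sym {x} {y} (p , q) = ℂ.trans (⟨⟩-conj x y)
    (p , ℝ.trans (ℝ.-‿cong q) -0#≈0#)
    where open RingProperties ℝ.ring using (-0#≈0#)

  ⊥-self : ∀ {x} → x ⊥ x → x ≈ᴹ 0ᴹ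
  ⊥-self = ⟨⟩-definite _

  perp : Carrierᴹ → Subspace
  perp w = record
    { member = _⊥ w
    ; respects = λ p q → ℂ.trans (⟨⟩-cong (≈ᴹ-sym p) ≈ᴹ-refl) q
    ; 0-closed = ℂ.trans (⟨⟩-cong (≈ᴹ-sym (*ₗ-zeroˡ 0ᴹ)) ≈ᴹ-refl)
                   (ℂ.trans (⟨⟩-*ˡ 0ℂ 0ᴹ w) (ℂ.zeroˡ _))
    ; +-closed = λ p q → ℂ.trans (⟨⟩-+ˡ _ _ w) (ℂ.trans (ℂ.+-cong p q) (ℂ.+-identityˡ 0ℂ))
    ; *ₗ-closed = λ a p → ℂ.trans (⟨⟩-*ˡ a _ w) (ℂ.trans (ℂ.*-congˡ p) (ℂ.zeroʳ a))
    }

  infixr 7 _⊓_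

  _⊓_ : Subspace → Subspace → Subspace
  V ⊓ W = record
    { member = member V ∩ member W
    ; respects = λ p (x , y) → respects V p x , respects W p y
    ; 0-closed = 0-closed V , 0-closed W
    ; +-closed = λ (x , y) (x′ , y′) → +-closed V x x′ , +-closed W y y′
    ; *ₗ-closed = λ a (x , y) → *ₗ-closed V a x , *ₗ-closed W a y
    }

  infix 8 _^⊥

  _^⊥ : Pred Carrierᴹ ℓ → Subspace
  S ^⊥ = record
    { member = λ x → ∀ s → s ∈ S → x ⊥ s
    ; respects = λ p f s m → respects (perp s) p (f s m)
    ; 0-closed = λ s _ → 0-closed (perp s)
    ; +-closed = λ f g s m → +-closed (perp s) (f s m) (g s m)
    ; *ₗ-closed = λ a f s m → *ₗ-closed (perp s) a (f s m)
    }

  adjoin : Subspace → Carrierᴹ → Subspace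
  adjoin V w = record
    { member = λ x → ∃[ c ] ∃[ v ] (v ∈ member V × x ≈ᴹ c *ₗ w +ᴹ v)
    ; respects = λ p (c , v , m , q) → c , v , m , ≈ᴹ-trans (≈ᴹ-sym p) q
    ; 0-closed = 0ℂ , 0ᴹ , 0-closed V , ≈ᴹ-sym (≈ᴹ-trans (+ᴹ-congʳ (*ₗ-zeroˡ w)) (+ᴹ-identityˡ 0ᴹ))
    ; +-closed = λ (c , v , m , q) (c′ , v′ , m′ , q′) → c ℂ.+ c′ , v +ᴹ v′ , +-closed V m m′ ,
        ≈ᴹ-trans (+ᴹ-cong q q′) (≈ᴹ-trans (+ᴹ-interchange _ _ _ _) (+ᴹ-congʳ (≈ᴹ-sym (*ₗ-distribʳ w c c′))))
    ; *ₗ-closed = λ a (c , v , m , q) → a ℂ.* c , a *ₗ v , *ₗ-closed V a m ,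
        ≈ᴹ-trans (*ₗ-congˡ q) (≈ᴹ-trans (*ₗ-distribˡ a _ _) (+ᴹ-congʳ (≈ᴹ-sym (*ₗ-assoc a c w))))
    }

  adjoin-⊆ : ∀ V w → member V ⊆ member (adjoin V w)
  adjoin-⊆ V w {x} x∈V = 0ℂ , x , x∈V , ≈ᴹ-sym (≈ᴹ-trans (+ᴹ-congʳ (*ₗ-zeroˡ w)) (+ᴹ-identityˡ x))

  adjoin-self : ∀ V w → w ∈ member (adjoin V w)
  adjoin-self V w = 1ℂ , 0ᴹ , 0-closed V , ≈ᴹ-sym (≈ᴹ-trans (+ᴹ-identityʳ _) (*ₗ-identityˡ w))

  adjoin-least : ∀ V w U → member V ⊆ member U → w ∈ member U → member (adjoin V w) ⊆ member U
  adjoin-least V w U V⊆U w∈U (c , v , m , q) =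
    respects U (≈ᴹ-sym q) (+-closed U (*ₗ-closed U c w∈U) (V⊆U m))

  neg-closed : ∀ V {x} → x ∈ member V → -ᴹ x ∈ member V
  neg-closed V {x} p = respects V (-1*ₗx≈-x x) (*ₗ-closed V (ℂ.- 1ℂ) p)

  remainder : ∀ {x a b} → x ≈ᴹ a +ᴹ b → b ≈ᴹ -ᴹ a +ᴹ x
  remainder {x} {a} {b} p = begin
    b                   ≈⟨ +ᴹ-identityˡ b ⟨
    0ᴹ +ᴹ b             ≈⟨ +ᴹ-congʳ (-ᴹ‿inverseˡ a) ⟨
    -ᴹ a +ᴹ a +ᴹ b      ≈⟨ +ᴹ-assoc _ a b ⟩
    -ᴹ a +ᴹ (a +ᴹ b)    ≈⟨ +ᴹ-congˡ p ⟨
    -ᴹ a +ᴹ x           ∎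
    where open SetoidReasoning ≈ᴹ-setoid

  -- Orthogonal splittings are kept as equations between `x` and a sum; with `perp w` for `V` this
  -- also cancels terms in orthogonality relations.
  ∈-remainder : ∀ V {x a b} → x ≈ᴹ a +ᴹ b → x ∈ member V → a ∈ member V → b ∈ member V
  ∈-remainder V p x∈V a∈V = respects V (≈ᴹ-sym (remainder p)) (+-closed V (neg-closed V a∈V) x∈V)

  ∈-remainderˡ : ∀ V {x a b} → x ≈ᴹ a +ᴹ b → x ∈ member V → b ∈ member V → a ∈ member V
  ∈-remainderˡ V p = ∈-remainder V (≈ᴹ-trans p (+ᴹ-comm _ _))

  decompose : ∀ {u} → ¬ u ≈ᴹ 0ᴹ → ∀ x → ∃[ c ] ∃[ r ] (x ≈ᴹ c *ₗ u +ᴹ r × r ⊥ u)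
  decompose {u} u≉0 x = c , r , x≈cu+r , r⊥u
    where
    q≉0 : ¬ ⟨ u , u ⟩ ≈ℂ 0ℂ
    q≉0 p = u≉0 (⊥-self p)
    i = proj₁ (ℂ-inverse ⟨ u , u ⟩ q≉0)
    qi≈1 : ⟨ u , u ⟩ *ℂ i ≈ℂ 1ℂ
    qi≈1 = proj₂ (ℂ-inverse ⟨ u , u ⟩ q≉0)
    c = ⟨ x , u ⟩ *ℂ i
    r = -ᴹ (c *ₗ u) +ᴹ x
    x≈cu+r : x ≈ᴹ c *ₗ u +ᴹ r
    x≈cu+r = ≈ᴹ-sym (≈ᴹ-trans (≈ᴹ-sym (+ᴹ-assoc _ _ x)) (≈ᴹ-trans (+ᴹ-congʳ (-ᴹ‿inverseʳ _)) (+ᴹ-identityˡ x)))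
    r⊥u : r ⊥ u
    r⊥u = begin
      ⟨ r , u ⟩                                          ≈⟨ ⟨⟩-+ˡ _ x u ⟩
      ⟨ -ᴹ (c *ₗ u) , u ⟩ ℂ.+ ⟨ x , u ⟩                  ≈⟨ ℂ.+-congʳ (⟨⟩-cong (-1*ₗx≈-x (c *ₗ u)) ≈ᴹ-refl) ⟨
      ⟨ (ℂ.- 1ℂ) *ₗ c *ₗ u , u ⟩ ℂ.+ ⟨ x , u ⟩           ≈⟨ ℂ.+-congʳ (ℂ.trans (⟨⟩-*ˡ _ _ u) (ℂ.*-congˡ (⟨⟩-*ˡ c u u))) ⟩
      (ℂ.- 1ℂ) *ℂ (c *ℂ ⟨ u , u ⟩) ℂ.+ ⟨ x , u ⟩         ≈⟨ ℂ.+-congʳ (-1*x≈-x _) ⟩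
      ℂ.- (c *ℂ ⟨ u , u ⟩) ℂ.+ ⟨ x , u ⟩                 ≈⟨ ℂ.+-congʳ (ℂ.-‿cong cq≈) ⟩
      ℂ.- ⟨ x , u ⟩ ℂ.+ ⟨ x , u ⟩                        ≈⟨ ℂ.-‿inverseˡ _ ⟩
      0ℂ                                                 ∎
      where
      open SetoidReasoning ℂ.setoid
      open RingProperties ℂ.ring using (-1*x≈-x)
      cq≈ : c *ℂ ⟨ u , u ⟩ ≈ℂ ⟨ x , u ⟩
      cq≈ = ℂ.trans (ℂ.*-assoc _ i _) (ℂ.trans (ℂ.*-congˡ (ℂ.trans (ℂ.*-comm i _) qi≈1)) (ℂ.*-identityʳ _))

  combination-∈ : ∀ V {n} a (v : Vector Carrierᴹ n) → (∀ i → v i ∈ member V) → linearCombination a v ∈ member V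
  combination-∈ V {zero}  a v f = 0-closed V
  combination-∈ V {suc n} a v f =
    +-closed V (*ₗ-closed V (a zero) (f zero)) (combination-∈ V (a ∘ suc) (v ∘ suc) (f ∘ suc))

  combination-zero : ∀ {n} (v : Vector Carrierᴹ n) → linearCombination (λ _ → 0ℂ) v ≈ᴹ 0ᴹ
  combination-zero {zero}  v = ≈ᴹ-refl
  combination-zero {suc n} v =
    ≈ᴹ-trans (+ᴹ-cong (*ₗ-zeroˡ (v zero)) (combination-zero (v ∘ suc))) (+ᴹ-identityˡ 0ᴹ)

-- Dimension by orthogonal reduction

module Dimension {ℓ} (em : ExcludedMiddle ℓ) {ℝ : RealNumbers ℓ} (H : HilbertSpace ℝ) where
  open HilbertSpace H
  open Subspaces H
  open Orthogonality em H
  private module ℂ = CommutativeRing ℂ-commutativeRing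

  -- Equivalent to HasDimension, but suited to induction.
  Dim : Subspace → ℕ → Set ℓ
  Dim V zero    = ∀ x → x ∈ member V → x ≈ᴹ 0ᴹ
  Dim V (suc n) = ∃[ u ] (u ∈ member V × ¬ u ≈ᴹ 0ᴹ × Dim (V ⊓ perp u) n)

  Dim-resp : ∀ {n} V W → member V ≐ member W → Dim V n → Dim W n
  Dim-resp {zero}  V W (V⊆W , W⊆V) D = λ x x∈W → D x (W⊆V x∈W)
  Dim-resp {suc n} V W (V⊆W , W⊆V) (u , u∈V , u≉0 , D) =
    u , V⊆W u∈V , u≉0 , Dim-resp (V ⊓ perp u) (W ⊓ perp u)
      ((λ (p , q) → V⊆W p , q) , (λ (p , q) → W⊆V p , q)) D

  -- After projecting to `V ⊓ perp u`, the rest `s` is split along `u`; its part `r` stays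
  -- orthogonal to `V ⊓ perp u` because both `s` and `u` are.
  project : ∀ {n} V → Dim V n → ∀ x →
    ∃[ p ] ∃[ r ] (x ≈ᴹ p +ᴹ r × p ∈ member V × r ∈ member (member V ^⊥))
  project {zero}  V D x = 0ᴹ , x , ≈ᴹ-sym (+ᴹ-identityˡ x) , 0-closed V ,
    λ s s∈V → ⊥-sym (respects (perp x) (≈ᴹ-sym (D s s∈V)) (0-closed (perp x)))
  project {suc n} V (u , u∈V , u≉0 , D) x =
    let (q , s , x≈q+s , (q∈V , q⊥u) , s⊥W) = project (V ⊓ perp u) D x
        (c , r , s≈cu+r , r⊥u) = decompose u≉0 s
    in q +ᴹ c *ₗ u , r ,
       ≈ᴹ-trans x≈q+s (≈ᴹ-trans (+ᴹ-congˡ s≈cu+r) (≈ᴹ-sym (+ᴹ-assoc q _ r))) ,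
       +-closed V q∈V (*ₗ-closed V c u∈V) ,
       λ v v∈V →
         let (b , w , v≈bu+w , w⊥u) = decompose u≉0 v
             w∈V = ∈-remainder V v≈bu+w v∈V (*ₗ-closed V b u∈V)
             r⊥w = ∈-remainder (perp w) s≈cu+r (s⊥W w (w∈V , w⊥u)) (*ₗ-closed (perp w) c (⊥-sym w⊥u))
         in ⊥-sym (respects (perp r) (≈ᴹ-sym v≈bu+w)
              (+-closed (perp r) (*ₗ-closed (perp r) b (⊥-sym r⊥u)) (⊥-sym r⊥w)))

  -- `Dim` singles out one first vector `u`; any nonzero `w` can take its place. If `w` is a
  -- multiple of `u`, both cut out the same section. Otherwise `u , w′` and `w , u′` are orthogonal
  -- bases of the same plane, so cutting by either pair gives the same subspace, and the induction
  -- runs inside `V ⊓ perp u` with `w′`.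
  exchange : ∀ {n} V → Dim V (suc n) → ∀ {w} → w ∈ member V → ¬ w ≈ᴹ 0ᴹ → Dim (V ⊓ perp w) n
  exchange {n} V (u , u∈V , u≉0 , D) {w} w∈V w≉0 = cases
    where
    c   = proj₁ (decompose u≉0 w)
    w′  = proj₁ (proj₂ (decompose u≉0 w))
    w≈  : w ≈ᴹ c *ₗ u +ᴹ w′
    w≈  = proj₁ (proj₂ (proj₂ (decompose u≉0 w)))
    w′⊥u : w′ ⊥ u
    w′⊥u = proj₂ (proj₂ (proj₂ (decompose u≉0 w)))
    b   = proj₁ (decompose w≉0 u)
    u′  = proj₁ (proj₂ (decompose w≉0 u))
    u≈  : u ≈ᴹ b *ₗ w +ᴹ u′
    u≈  = proj₁ (proj₂ (proj₂ (decompose w≉0 u)))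
    u′⊥w : u′ ⊥ w
    u′⊥w = proj₂ (proj₂ (proj₂ (decompose w≉0 u)))

    drop-zero : ∀ {x a r} → x ≈ᴹ a +ᴹ r → r ≈ᴹ 0ᴹ → x ≈ᴹ a
    drop-zero p q = ≈ᴹ-trans p (≈ᴹ-trans (+ᴹ-congˡ q) (+ᴹ-identityʳ _))

    u⊥ : ∀ {x} → x ⊥ w → x ⊥ u′ → x ⊥ u
    u⊥ {x} p q = ⊥-sym (respects (perp x) (≈ᴹ-sym u≈)
      (+-closed (perp x) (*ₗ-closed (perp x) b (⊥-sym p)) (⊥-sym q)))
    w⊥ : ∀ {x} → x ⊥ u → x ⊥ w′ → x ⊥ w
    w⊥ {x} p q = ⊥-sym (respects (perp x) (≈ᴹ-sym w≈)
      (+-closed (perp x) (*ₗ-closed (perp x) c (⊥-sym p)) (⊥-sym q)))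
    w′⊥ : ∀ {x} → x ⊥ w → x ⊥ u → x ⊥ w′
    w′⊥ {x} p q = ⊥-sym (∈-remainder (perp x) w≈ (⊥-sym p) (*ₗ-closed (perp x) c (⊥-sym q)))
    u′⊥ : ∀ {x} → x ⊥ w → x ⊥ u → x ⊥ u′
    u′⊥ {x} p q = ⊥-sym (∈-remainder (perp x) u≈ (⊥-sym q) (*ₗ-closed (perp x) b (⊥-sym p)))

    proportional : w′ ≈ᴹ 0ᴹ → Dim (V ⊓ perp w) n
    proportional w′≈0 = Dim-resp (V ⊓ perp u) (V ⊓ perp w)
      ( (λ (x∈V , x⊥u) → x∈V , scale w≈cu x⊥u)
      , (λ (x∈V , x⊥w) → x∈V , scale (proj₂ (multiple-sym w≉0 w≈cu)) x⊥w)) D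
      where
      w≈cu = drop-zero w≈ w′≈0
      scale : ∀ {y z d x} → y ≈ᴹ d *ₗ z → x ⊥ z → x ⊥ y
      scale {d = d} {x} p q = ⊥-sym (respects (perp x) (≈ᴹ-sym p) (*ₗ-closed (perp x) d (⊥-sym q)))

    independent : ∀ {m} → ¬ w′ ≈ᴹ 0ᴹ → Dim (V ⊓ perp u) m → Dim (V ⊓ perp w) m
    independent {zero}  w′≉0 D = contradiction (D w′ (w′∈V , w′⊥u)) w′≉0
      where w′∈V = ∈-remainder V w≈ w∈V (*ₗ-closed V c u∈V)
    independent {suc m} w′≉0 D = u′ , (u′∈V , u′⊥w) , u′≉0 ,
      Dim-resp ((V ⊓ perp u) ⊓ perp w′) ((V ⊓ perp w) ⊓ perp u′)
        ( (λ ((x∈V , x⊥u) , x⊥w′) → let x⊥w = w⊥ x⊥u x⊥w′ in (x∈V , x⊥w) , u′⊥ x⊥w x⊥u)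
        , (λ ((x∈V , x⊥w) , x⊥u′) → let x⊥u = u⊥ x⊥w x⊥u′ in (x∈V , x⊥u) , w′⊥ x⊥w x⊥u))
        (exchange (V ⊓ perp u) D (w′∈V , w′⊥u) w′≉0)
      where
      w′∈V = ∈-remainder V w≈ w∈V (*ₗ-closed V c u∈V)
      u′∈V = ∈-remainder V u≈ u∈V (*ₗ-closed V b w∈V)
      u′≉0 : ¬ u′ ≈ᴹ 0ᴹ
      -- If `u` were a multiple of `w`, then `w` would be one of `u`, and `w′` would be orthogonal
      -- to `u`, to `w` and hence to itself.
      u′≉0 u′≈0 =
        let (d , w≈du) = multiple-sym u≉0 (drop-zero u≈ u′≈0)
            w′⊥w = ⊥-sym (respects (perp w′) (≈ᴹ-sym w≈du) (*ₗ-closed (perp w′) d (⊥-sym w′⊥u)))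
        in w′≉0 (⊥-self (w′⊥ w′⊥w w′⊥u))

    cases : Dim (V ⊓ perp w) n
    cases with em {w′ ≈ᴹ 0ᴹ}
    ... | yes w′≈0 = proportional w′≈0
    ... | no w′≉0  = independent w′≉0 D

  -- By `exchange`, the first vector of `U` can also be removed first from `V`.
  Dim-mono : ∀ {m n} U V → member U ⊆ member V → Dim U m → Dim V n → m ℕ.≤ n
  Dim-mono {zero}          U V U⊆V D E = ℕ.z≤n
  Dim-mono {suc m} {zero}  U V U⊆V (u , u∈U , u≉0 , D) E = contradiction (E u (U⊆V u∈U)) u≉0
  Dim-mono {suc m} {suc n} U V U⊆V (u , u∈U , u≉0 , D) E =
    ℕ.s≤s (Dim-mono (U ⊓ perp u) (V ⊓ perp u) (λ (p , q) → U⊆V p , q) D (exchange V E (U⊆V u∈U) u≉0))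

  -- A vector of `V` outside `U` has a nonzero part `r` orthogonal to `U`; then `U` fits into
  -- `V ⊓ perp r`, whose dimension is too small.
  Dim-⊆⇒⊇ : ∀ {n} U V → member U ⊆ member V → Dim U n → Dim V n → member V ⊆ member U
  Dim-⊆⇒⊇ {n} U V U⊆V D E {v} v∈V = from (project U D v)
    where
    from : (∃[ p ] ∃[ r ] (v ≈ᴹ p +ᴹ r × p ∈ member U × r ∈ member (member U ^⊥))) → v ∈ member U
    from (p , r , v≈p+r , p∈U , r⊥U) = respects U (≈ᴹ-sym (≈ᴹ-trans v≈p+r (≈ᴹ-trans (+ᴹ-congˡ r≈0) (+ᴹ-identityʳ p)))) p∈U
      where
      r∈V = ∈-remainder V v≈p+r v∈V (U⊆V p∈U)
      impossible : ∀ {m} → m ≡ n → Dim V m → ¬ ¬ r ≈ᴹ 0ᴹ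
      impossible {zero}  _ E r≉0      = r≉0 (E r r∈V)
      impossible {suc m} ≡.refl E r≉0 = ℕ.<-irrefl ≡.refl
        (Dim-mono U (V ⊓ perp r) (λ u∈U → U⊆V u∈U , ⊥-sym (r⊥U _ u∈U)) D (exchange V E r∈V r≉0))
      r≈0 : r ≈ᴹ 0ᴹ
      r≈0 = decidable-stable em (impossible ≡.refl E)

  Dim-sub : ∀ {n} U V → member U ⊆ member V → Dim V n → ∃[ m ] Dim U m
  Dim-sub U V U⊆V D with em {∃[ u ] (u ∈ member U × ¬ u ≈ᴹ 0ᴹ)}
  ... | no trivial = 0 , λ x x∈U → decidable-stable em (λ x≉0 → trivial (x , x∈U , x≉0))
  Dim-sub {zero}  U V U⊆V D | yes (u , u∈U , u≉0) = contradiction (D u (U⊆V u∈U)) u≉0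
  Dim-sub {suc n} U V U⊆V D | yes (u , u∈U , u≉0) =
    let (m , E) = Dim-sub (U ⊓ perp u) (V ⊓ perp u) (λ (p , q) → U⊆V p , q) (exchange V D (U⊆V u∈U) u≉0)
    in suc m , u , u∈U , u≉0 , E

  -- On `V`, orthogonality to `w` is orthogonality to the projection `p` of `w`, so the cases are
  -- `p` zero and `exchange` for `p`.
  hyperplane : ∀ {n} V w → Dim V (suc n) → member V ⊆ member (perp w) ⊎ Dim (V ⊓ perp w) n
  hyperplane {n} V w D = from (project V D w)
    where
    from : (∃[ p ] ∃[ r ] (w ≈ᴹ p +ᴹ r × p ∈ member V × r ∈ member (member V ^⊥))) →
           member V ⊆ member (perp w) ⊎ Dim (V ⊓ perp w) n
    from (p , r , w≈p+r , p∈V , r⊥V) with em {p ≈ᴹ 0ᴹ}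
    ... | yes p≈0 = inj₁ λ {v} v∈V → ⊥-sym (respects (perp v)
              (≈ᴹ-sym (≈ᴹ-trans w≈p+r (≈ᴹ-trans (+ᴹ-congʳ p≈0) (+ᴹ-identityˡ r)))) (r⊥V v v∈V))
    ... | no p≉0  = inj₂ (Dim-resp (V ⊓ perp p) (V ⊓ perp w)
              ( (λ {x} (x∈V , x⊥p) → x∈V , ⊥-sym (respects (perp x) (≈ᴹ-sym w≈p+r) (+-closed (perp x) (⊥-sym x⊥p) (r⊥V x x∈V))))
              , (λ {x} (x∈V , x⊥w) → x∈V , ⊥-sym (∈-remainderˡ (perp x) w≈p+r (⊥-sym x⊥w) (r⊥V x x∈V))))
              (exchange V D p∈V p≉0))

  -- The part `r` of `w` orthogonal to `V` serves as first vector: its orthogonal complement within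
  -- `adjoin V w` is `V` again.
  Dim-adjoin : ∀ {n} V → Dim V n → ∀ {w} → ¬ w ∈ member V → Dim (adjoin V w) (suc n)
  Dim-adjoin {n} V D {w} w∉V = from (project V D w)
    where
    from : (∃[ p ] ∃[ r ] (w ≈ᴹ p +ᴹ r × p ∈ member V × r ∈ member (member V ^⊥))) → Dim (adjoin V w) (suc n)
    from (p , r , w≈p+r , p∈V , r⊥V) = r , r∈ , r≉0 , Dim-resp V (adjoin V w ⊓ perp r)
        ( (λ {x} x∈V → adjoin-⊆ V w x∈V , ⊥-sym (r⊥V x x∈V))
        , λ {x} ((c , v , v∈V , x≈) , x⊥r) →
            -- x = c r + (c p + v) with the second summand in V, so x ⊥ r forces c r = 0.
            let cr⊥r = ∈-remainder (perp r)
                         (≈ᴹ-trans x≈ (≈ᴹ-trans (+ᴹ-congʳ (≈ᴹ-trans (*ₗ-congˡ w≈p+r) (*ₗ-distribˡ c p r)))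
                           (≈ᴹ-trans (+ᴹ-congʳ (+ᴹ-comm _ _)) (≈ᴹ-trans (+ᴹ-assoc _ _ v) (+ᴹ-comm _ _)))))
                         x⊥r (⊥-sym (r⊥V _ (+-closed V (*ₗ-closed V c p∈V) v∈V)))
                cr≈0 = ⊥-self (⊥-sym (*ₗ-closed (perp (c *ₗ r)) c (⊥-sym cr⊥r)))
            in respects V (≈ᴹ-sym x≈) (+-closed V (respects V (≈ᴹ-sym
                 (≈ᴹ-trans (*ₗ-congˡ w≈p+r) (≈ᴹ-trans (*ₗ-distribˡ c p r) (≈ᴹ-trans (+ᴹ-congˡ cr≈0) (+ᴹ-identityʳ _)))))
                 (*ₗ-closed V c p∈V)) v∈V)) D
      where
      r∈ = ∈-remainder (adjoin V w) w≈p+r (adjoin-self V w) (adjoin-⊆ V w p∈V)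
      r≉0 : ¬ r ≈ᴹ 0ᴹ
      r≉0 r≈0 = w∉V (respects V (≈ᴹ-sym (≈ᴹ-trans w≈p+r (≈ᴹ-trans (+ᴹ-congˡ r≈0) (+ᴹ-identityʳ p)))) p∈V)

  combination-split : ∀ {n} {v r : Vector Carrierᴹ n} {u} (c : Vector ℂ n) → (∀ i → v i ≈ᴹ c i *ₗ u +ᴹ r i) →
    ∀ a → ∃[ d ] linearCombination a v ≈ᴹ d *ₗ u +ᴹ linearCombination a r
  combination-split {zero} {u = u} c v≈ a =
    0ℂ , ≈ᴹ-sym (≈ᴹ-trans (+ᴹ-congʳ (*ₗ-zeroˡ u)) (+ᴹ-identityˡ 0ᴹ))
  combination-split {suc n} {v} {r} {u} c v≈ a =
    let (d , e) = combination-split (c ∘ suc) (v≈ ∘ suc) (a ∘ suc)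
        s = linearCombination (a ∘ suc) (r ∘ suc)
    in a zero ℂ.* c zero ℂ.+ d , (begin
      a zero *ₗ v zero +ᴹ linearCombination (a ∘ suc) (v ∘ suc)
        ≈⟨ +ᴹ-cong (*ₗ-congˡ (v≈ zero)) e ⟩
      a zero *ₗ (c zero *ₗ u +ᴹ r zero) +ᴹ (d *ₗ u +ᴹ s)
        ≈⟨ +ᴹ-congʳ (≈ᴹ-trans (*ₗ-distribˡ _ _ _) (+ᴹ-congʳ (≈ᴹ-sym (*ₗ-assoc _ _ u)))) ⟩
      (a zero ℂ.* c zero) *ₗ u +ᴹ a zero *ₗ r zero +ᴹ (d *ₗ u +ᴹ s)
        ≈⟨ +ᴹ-interchange _ _ _ _ ⟩
      (a zero ℂ.* c zero) *ₗ u +ᴹ d *ₗ u +ᴹ (a zero *ₗ r zero +ᴹ s)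
        ≈⟨ +ᴹ-congʳ (*ₗ-distribʳ u _ d) ⟨
      (a zero ℂ.* c zero ℂ.+ d) *ₗ u +ᴹ (a zero *ₗ r zero +ᴹ s) ∎)
    where
    open SetoidReasoning ≈ᴹ-setoid

  drop-multiple : ∀ {x c u r} → ¬ u ≈ᴹ 0ᴹ → x ≈ᴹ c *ₗ u +ᴹ r → x ⊥ u → r ⊥ u → c *ₗ u ≈ᴹ 0ᴹ × x ≈ᴹ r
  drop-multiple {x} {c} {u} {r} u≉0 x≈ x⊥u r⊥u = cu≈0 , ≈ᴹ-trans x≈ (≈ᴹ-trans (+ᴹ-congʳ cu≈0) (+ᴹ-identityˡ r))
    where
    cu⊥u = ∈-remainderˡ (perp u) x≈ x⊥u r⊥u
    cu≈0 = ⊥-self (⊥-sym (*ₗ-closed (perp (c *ₗ u)) c (⊥-sym cu⊥u)))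

  -- One round of Gram-Schmidt: the components of the other vectors along the first are removed, and
  -- the remainders form a basis of `V ⊓ perp u`.
  HasDimension⇒Dim : ∀ {n} V → HasDimension (member V) n → Dim V n
  HasDimension⇒Dim {zero}  V (v , v∈V , indep , span) x x∈V = proj₂ (span x x∈V)
  HasDimension⇒Dim {suc n} V (v , v∈V , indep , span) =
    u , v∈V zero , u≉0 , HasDimension⇒Dim (V ⊓ perp u) (r , r∈ , r-indep , r-span)
    where
    u = v zero
    u≉0 : ¬ u ≈ᴹ 0ᴹ
    u≉0 u≈0 = 1≉0 (indep (1ℂ ∷ (λ _ → 0ℂ))
      (≈ᴹ-trans (+ᴹ-cong (≈ᴹ-trans (*ₗ-identityˡ u) u≈0) (combination-zero (v ∘ suc))) (+ᴹ-identityˡ 0ᴹ)) zero)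
    dec : ∀ i → _
    dec i = decompose u≉0 (v (suc i))
    c : Vector ℂ n
    c i = proj₁ (dec i)
    r : Vector Carrierᴹ n
    r i = proj₁ (proj₂ (dec i))
    v≈ : ∀ i → v (suc i) ≈ᴹ c i *ₗ u +ᴹ r i
    v≈ i = proj₁ (proj₂ (proj₂ (dec i)))
    r∈ : ∀ i → r i ∈ member (V ⊓ perp u)
    r∈ i = ∈-remainder V (v≈ i) (v∈V (suc i)) (*ₗ-closed V (c i) (v∈V zero)) , proj₂ (proj₂ (proj₂ (dec i)))
    r-indep : LinearlyIndependent r
    r-indep a a≈0 i =
      let (d , e) = combination-split c v≈ a
      -- The coefficient of `u` cancels the multiple of `u` by which the combinations of `v` and of
      -- `r` differ.
      in indep ((ℂ.- d) ∷ a) (begin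
           (ℂ.- d) *ₗ u +ᴹ linearCombination a (v ∘ suc)  ≈⟨ +ᴹ-congˡ (≈ᴹ-trans e (≈ᴹ-trans (+ᴹ-congˡ a≈0) (+ᴹ-identityʳ _))) ⟩
           (ℂ.- d) *ₗ u +ᴹ d *ₗ u                         ≈⟨ *ₗ-distribʳ u _ d ⟨
           (ℂ.- d ℂ.+ d) *ₗ u                             ≈⟨ *ₗ-congʳ (ℂ.-‿inverseˡ d) ⟩
           0ℂ *ₗ u                                        ≈⟨ *ₗ-zeroˡ u ⟩
           0ᴹ                                             ∎) (suc i)
      where open SetoidReasoning ≈ᴹ-setoid
    r-span : ∀ x → x ∈ member (V ⊓ perp u) → ∃[ a ] x ≈ᴹ linearCombination a r
    r-span x (x∈V , x⊥u) =
      let (a , x≈) = span x x∈V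
          (d , e) = combination-split c v≈ (a ∘ suc)
      in a ∘ suc , proj₂ (drop-multiple {c = a zero ℂ.+ d} u≉0
           (≈ᴹ-trans x≈ (≈ᴹ-trans (+ᴹ-congˡ e) (≈ᴹ-trans (≈ᴹ-sym (+ᴹ-assoc _ _ _)) (+ᴹ-congʳ (≈ᴹ-sym (*ₗ-distribʳ u _ d))))))
           x⊥u (combination-∈ (perp u) (a ∘ suc) r (proj₂ ∘ r∈)))

  Dim⇒HasDimension : ∀ {n} V → Dim V n → HasDimension (member V) n
  Dim⇒HasDimension {zero}  V D = (λ ()) , (λ ()) , (λ a _ ()) , λ x x∈V → (λ ()) , D x x∈V
  Dim⇒HasDimension {suc n} V (u , u∈V , u≉0 , D) = extend (Dim⇒HasDimension (V ⊓ perp u) D)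
    where
    extend : HasDimension (member (V ⊓ perp u)) n → HasDimension (member V) (suc n)
    extend (v , v∈ , indep , span) = u ∷ v
      , (λ { zero → u∈V ; (suc i) → proj₁ (v∈ i) })
      , (λ a a≈0 → let (au≈0 , 0≈s) = drop-multiple u≉0 (≈ᴹ-sym a≈0) (0-closed (perp u))
                                         (combination-∈ (perp u) (a ∘ suc) v (proj₂ ∘ v∈))
                   in λ { zero → *ₗ-cancel au≈0 u≉0 ; (suc i) → indep (a ∘ suc) (≈ᴹ-sym 0≈s) i })
      , (λ x x∈V → let (c , r , x≈ , r⊥u) = decompose u≉0 x
                       (a , r≈) = span r (∈-remainder V x≈ x∈V (*ₗ-closed V c u∈V) , r⊥u)
                   in c ∷ a , ≈ᴹ-trans x≈ (+ᴹ-congˡ r≈))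

-- Closed spans and the projection theorem

module ProjectionTheorem {ℓ} (em : ExcludedMiddle ℓ) {ℝ : RealNumbers ℓ} (H : HilbertSpace ℝ) where
  open HilbertSpace H
  open Subspaces H
  open Orthogonality em H
  private
    module ℝ where
      open RealNumbers ℝ public
      open RealProperties em ℝ public
    module ℂ = CommutativeRing ℂ-commutativeRing
  open ℝ using (_+_; _-_; solve; _:+_; _:*_; _:-_; :-_; _:=_)
  open AbelianGroupProperties +ᴹ-abelianGroup using () renaming (⁻¹-∙-comm to -ᴹ-+ᴹ-comm)

  square-+-≤ : ∀ a b → (a + b) * (a + b) ≤ (a * a + a * a) + (b * b + b * b)
  square-+-≤ a b = ℝ.≤-by (ℝ.square-nonNeg (a - b))
    (solve 2 (λ a b → (a :* a :+ a :* a) :+ (b :* b :+ b :* b) :- (a :+ b) :* (a :+ b) := (a :- b) :* (a :- b)) ℝ.refl a b)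

  square-pos : ∀ {ε} → 0# < ε → 0# < ε * ε
  square-pos p = ℝ.*-pos p p

  -- Choosing `ε * ε` as `η / (1 + q)` makes the bound at most `η`. The summand `1` allows `q` to be
  -- zero, and `sqrt` enters because it is the square of `ε` that is prescribed.
  zero-from-ε : ∀ {a q} → 0# ≤ q → (∀ ε → 0# < ε → a * a ≤ q * (ε * ε)) → a ℝ.≈ 0#
  zero-from-ε {a} {q} 0≤q f = ℝ.square-zero (ℝ.≤-from-ε λ η 0<η →
    let (i , 0<i , [1+q]i≈1) = ℝ.pos-inverse (ℝ.+-pos ℝ.0<1 0≤q)
        (ε , 0≤ε , ε²≈ηi) = ℝ.sqrt (η * i) (proj₁ (ℝ.*-pos 0<η 0<i))
    in below η i ε (ℝ.*-pos 0<η 0<i) [1+q]i≈1 0≤ε ε²≈ηi)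
    where
    below : ∀ η i ε → 0# < η * i → (ℝ.1# + q) * i ℝ.≈ ℝ.1# → 0# ≤ ε → ε * ε ℝ.≈ η * i → a * a ≤ η
    below η i ε 0<ηi [1+q]i≈1 0≤ε ε²≈ηi = ℝ.≤-trans (f ε 0<ε) (ℝ.≤-by (proj₁ 0<ηi) (begin
      η - q * (ε * ε)
        ≈⟨ ℝ.+-cong (ℝ.trans (ℝ.sym (ℝ.*-identityʳ η)) (ℝ.*-congˡ (ℝ.sym [1+q]i≈1))) (ℝ.-‿cong (ℝ.*-congˡ ε²≈ηi)) ⟩
      η * ((ℝ.1# + q) * i) - q * (η * i)
        ≈⟨ solve 4 (λ o η q i → η :* ((o :+ q) :* i) :- q :* (η :* i) := o :* (η :* i)) ℝ.refl ℝ.1# η q i ⟩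
      ℝ.1# * (η * i)
        ≈⟨ ℝ.*-identityˡ _ ⟩
      η * i ∎))
      where
      open SetoidReasoning ℝ.setoid
      0<ε : 0# < ε
      0<ε = 0≤ε , λ 0≈ε → proj₂ 0<ηi (ℝ.trans (ℝ.trans (ℝ.sym (ℝ.zeroˡ 0#)) (ℝ.*-cong 0≈ε 0≈ε)) ε²≈ηi)

  discriminant : ∀ {δ a q} → 0# < q → (∀ t → 0# ≤ δ - (t * a + t * a) + t * t * q) → a * a ≤ δ * q
  discriminant {δ} {a} {q} 0<q f =
    let (i , 0<i , qi≈1) = ℝ.pos-inverse 0<q
    -- The parabola is evaluated at its vertex `a / q`.
    in ℝ.≤-by (ℝ.*-nonNeg (proj₁ 0<q) (f (a * i))) (begin
      δ * q - a * a
        ≈⟨ solve 3 (λ δ q a → δ :* q :- a :* a := δ :* q :- (a :* a :+ a :* a) :+ a :* a) ℝ.refl δ q a ⟩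
      δ * q - (a * a + a * a) + a * a
        ≈⟨ ℝ.+-cong (ℝ.+-congˡ (ℝ.-‿cong (ℝ.trans (ℝ.sym (ℝ.*-identityʳ _)) (ℝ.*-congˡ (ℝ.sym qi≈1)))))
                    (ℝ.trans (ℝ.sym (ℝ.*-identityʳ _)) (ℝ.*-congˡ (ℝ.trans (ℝ.sym (ℝ.*-identityʳ _)) (ℝ.*-cong (ℝ.sym qi≈1) (ℝ.sym qi≈1))))) ⟩
      δ * q - (a * a + a * a) * (q * i) + a * a * ((q * i) * (q * i))
        ≈⟨ solve 4 (λ δ q a i → δ :* q :- (a :* a :+ a :* a) :* (q :* i) :+ a :* a :* ((q :* i) :* (q :* i))
             := q :* (δ :- (a :* i :* a :+ a :* i :* a) :+ a :* i :* (a :* i) :* q)) ℝ.refl δ q a i ⟩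
      q * (δ - (a * i * a + a * i * a) + a * i * (a * i) * q) ∎)
    where open SetoidReasoning ℝ.setoid

  -- The real inner product underlying `⟨_,_⟩`. Distances see only this part, so estimates are made
  -- for it, and `⊥-from-real` returns to complex orthogonality.
  ⟪_,_⟫ : Carrierᴹ → Carrierᴹ → RealNumbers.Carrier ℝ
  ⟪ x , y ⟫ = Re ⟨ x , y ⟩

  ⟪⟫-cong : ∀ {x x′ y y′} → x ≈ᴹ x′ → y ≈ᴹ y′ → ⟪ x , y ⟫ ℝ.≈ ⟪ x′ , y′ ⟫
  ⟪⟫-cong p q = proj₁ (⟨⟩-cong p q)

  ⟪⟫-sym : ∀ x y → ⟪ x , y ⟫ ℝ.≈ ⟪ y , x ⟫
  ⟪⟫-sym x y = proj₁ (⟨⟩-conj y x)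

  ⟪⟫-negˡ : ∀ x y → ⟪ -ᴹ x , y ⟫ ℝ.≈ ℝ.- ⟪ x , y ⟫
  ⟪⟫-negˡ x y = proj₁ (begin
    ⟨ -ᴹ x , y ⟩            ≈⟨ ⟨⟩-cong (-1*ₗx≈-x x) ≈ᴹ-refl ⟨
    ⟨ (ℂ.- 1ℂ) *ₗ x , y ⟩   ≈⟨ ⟨⟩-*ˡ _ x y ⟩
    (ℂ.- 1ℂ) *ℂ ⟨ x , y ⟩   ≈⟨ -1*x≈-x _ ⟩
    ℂ.- ⟨ x , y ⟩           ∎)
    where
    open SetoidReasoning ℂ.setoid
    open RingProperties ℂ.ring using (-1*x≈-x)

  ⟪⟫--ˡ : ∀ x y z → ⟪ x -ᴹ y , z ⟫ ℝ.≈ ⟪ x , z ⟫ - ⟪ y , z ⟫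
  ⟪⟫--ˡ x y z = ℝ.trans (proj₁ (⟨⟩-+ˡ x (-ᴹ y) z)) (ℝ.+-congˡ (⟪⟫-negˡ y z))

  ⟪⟫--ʳ : ∀ x y z → ⟪ z , x -ᴹ y ⟫ ℝ.≈ ⟪ z , x ⟫ - ⟪ z , y ⟫
  ⟪⟫--ʳ x y z = ℝ.trans (⟪⟫-sym z _) (ℝ.trans (⟪⟫--ˡ x y z) (ℝ.+-cong (⟪⟫-sym x z) (ℝ.-‿cong (⟪⟫-sym y z))))

  ‖-‖²-expand : ∀ x y → ‖ x -ᴹ y ‖² ℝ.≈ ‖ x ‖² - (⟪ x , y ⟫ + ⟪ x , y ⟫) + ‖ y ‖²
  ‖-‖²-expand x y = begin
    ⟪ x -ᴹ y , x -ᴹ y ⟫                                      ≈⟨ ⟪⟫--ˡ x y _ ⟩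
    ⟪ x , x -ᴹ y ⟫ - ⟪ y , x -ᴹ y ⟫                          ≈⟨ ℝ.+-cong (⟪⟫--ʳ x y x) (ℝ.-‿cong (⟪⟫--ʳ x y y)) ⟩
    (⟪ x , x ⟫ - ⟪ x , y ⟫) - (⟪ y , x ⟫ - ⟪ y , y ⟫)        ≈⟨ ℝ.+-congˡ (ℝ.-‿cong (ℝ.+-congʳ (⟪⟫-sym y x))) ⟩
    (⟪ x , x ⟫ - ⟪ x , y ⟫) - (⟪ x , y ⟫ - ⟪ y , y ⟫)
      ≈⟨ solve 3 (λ a b c → (a :- b) :- (b :- c) := a :- (b :+ b) :+ c) ℝ.refl _ _ _ ⟩
    ‖ x ‖² - (⟪ x , y ⟫ + ⟪ x , y ⟫) + ‖ y ‖²                ∎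
    where open SetoidReasoning ℝ.setoid

  ‖-‖²-sym : ∀ x y → ‖ x -ᴹ y ‖² ℝ.≈ ‖ y -ᴹ x ‖²
  ‖-‖²-sym x y = ℝ.trans (‖-‖²-expand x y) (ℝ.trans
    (ℝ.+-congʳ (ℝ.+-congˡ (ℝ.-‿cong (ℝ.+-cong (⟪⟫-sym x y) (⟪⟫-sym x y)))))
    (ℝ.trans (solve 3 (λ a b c → a :- (b :+ b) :+ c := c :- (b :+ b) :+ a) ℝ.refl _ _ _) (ℝ.sym (‖-‖²-expand y x))))

  ⟪⟫-scaleˡ : ∀ t x y → ⟪ (t , 0#) *ₗ x , y ⟫ ℝ.≈ t * ⟪ x , y ⟫
  ⟪⟫-scaleˡ t x y = ℝ.trans (proj₁ (⟨⟩-*ˡ (t , 0#) x y))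
    (ℝ.trans (ℝ.+-congˡ (ℝ.trans (ℝ.-‿cong (ℝ.zeroˡ _)) -0#≈0#)) (ℝ.+-identityʳ _))
    where open RingProperties ℝ.ring using (-0#≈0#)

  ⟪⟫-scaleʳ : ∀ t x y → ⟪ x , (t , 0#) *ₗ y ⟫ ℝ.≈ t * ⟪ x , y ⟫
  ⟪⟫-scaleʳ t x y = ℝ.trans (⟪⟫-sym x _) (ℝ.trans (⟪⟫-scaleˡ t y x) (ℝ.*-congˡ (⟪⟫-sym y x)))

  ‖‖²-scale : ∀ t x → ‖ (t , 0#) *ₗ x ‖² ℝ.≈ t * t * ‖ x ‖²
  ‖‖²-scale t x = ℝ.trans (⟪⟫-scaleˡ t x _) (ℝ.trans (ℝ.*-congˡ (⟪⟫-scaleʳ t x x)) (ℝ.sym (ℝ.*-assoc t t _)))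

  ⟨x,x⟩≈‖x‖² : ∀ x → ⟨ x , x ⟩ ≈ℂ (‖ x ‖² , 0#)
  ⟨x,x⟩≈‖x‖² x = ℝ.refl , self-conjugate
    where
    b = Im ⟨ x , x ⟩
    b≈-b : b ℝ.≈ ℝ.- b
    b≈-b = proj₂ (⟨⟩-conj x x)
    -- Squaring turns `b ≈ - b` into `b * b ≤ 0#`, without dividing by two.
    b²≈-b² : b * b ℝ.≈ ℝ.- (b * b)
    b²≈-b² = ℝ.trans (ℝ.*-congˡ b≈-b) (solve 1 (λ b → b :* :- b := :- (b :* b)) ℝ.refl b)
    self-conjugate : b ℝ.≈ 0#
    self-conjugate = ℝ.square-zero (ℝ.≤-by (ℝ.square-nonNeg b)
      (ℝ.trans (ℝ.+-identityˡ _) (ℝ.sym b²≈-b²)))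

  ‖‖²-definite : ∀ {x} → ‖ x ‖² ℝ.≈ 0# → x ≈ᴹ 0ᴹ
  ‖‖²-definite {x} p = ⟨⟩-definite x (ℂ.trans (⟨x,x⟩≈‖x‖² x) (p , ℝ.refl))

  -- z almost attains the minimum of the distance along the line z - ℝw, so it is almost orthogonal to w.
  variational : ∀ {N δ} z w → ‖ z ‖² ≤ N + δ → (∀ t → N ≤ ‖ z -ᴹ (t , 0#) *ₗ w ‖²) →
    ⟪ z , w ⟫ * ⟪ z , w ⟫ ≤ δ * ‖ w ‖²
  variational {N} {δ} z w ‖z‖²≤ f with em {‖ w ‖² ℝ.≈ 0#}
  ... | yes q≈0 = ℝ.≤-reflexive (ℝ.trans (ℝ.*-congˡ a≈0) (ℝ.trans (ℝ.zeroʳ _) (ℝ.sym (ℝ.trans (ℝ.*-congˡ q≈0) (ℝ.zeroʳ δ)))))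
    where
    a≈0 : ⟪ z , w ⟫ ℝ.≈ 0#
    a≈0 = proj₁ (⊥-sym (respects (perp z) (≈ᴹ-sym (‖‖²-definite q≈0)) (0-closed (perp z))))
  ... | no q≉0 = discriminant (⟨⟩-nonNeg w , λ e → q≉0 (ℝ.sym e)) λ t →
    let open SetoidReasoning ℝ.setoid in
    ℝ.≤-respʳ-≈ (begin
      (N + δ - ‖ z ‖²) + (‖ z -ᴹ (t , 0#) *ₗ w ‖² - N)
        ≈⟨ ℝ.+-congˡ (ℝ.+-congʳ (‖-‖²-expand z _)) ⟩
      (N + δ - ‖ z ‖²) + (‖ z ‖² - (⟪ z , (t , 0#) *ₗ w ⟫ + ⟪ z , (t , 0#) *ₗ w ⟫) + ‖ (t , 0#) *ₗ w ‖² - N)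
        ≈⟨ ℝ.+-congˡ (ℝ.+-congʳ (ℝ.+-cong (ℝ.+-congˡ (ℝ.-‿cong (ℝ.+-cong (⟪⟫-scaleʳ t z w) (⟪⟫-scaleʳ t z w)))) (‖‖²-scale t w))) ⟩
      (N + δ - ‖ z ‖²) + (‖ z ‖² - (t * ⟪ z , w ⟫ + t * ⟪ z , w ⟫) + t * t * ‖ w ‖² - N)
        ≈⟨ solve 6 (λ N δ z t a q → (N :+ δ :- z) :+ (z :- (t :* a :+ t :* a) :+ t :* t :* q :- N)
             := δ :- (t :* a :+ t :* a) :+ t :* t :* q) ℝ.refl N δ ‖ z ‖² t ⟪ z , w ⟫ ‖ w ‖² ⟩
      δ - (t * ⟪ z , w ⟫ + t * ⟪ z , w ⟫) + t * t * ‖ w ‖² ∎)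
    (ℝ.+-nonNeg (ℝ.≤⇒0≤- ‖z‖²≤) (ℝ.≤⇒0≤- (f t)))

  -- This is `variational` with lower bound zero and all of `‖ z ‖²` as excess.
  cauchy-schwarz : ∀ z w → ⟪ z , w ⟫ * ⟪ z , w ⟫ ≤ ‖ z ‖² * ‖ w ‖²
  cauchy-schwarz z w = variational z w (ℝ.≤-reflexive (ℝ.sym (ℝ.+-identityˡ _))) (λ t → ⟨⟩-nonNeg _)

  𝕚 : ℂ
  𝕚 = 0# , ℝ.1#

  -- The real part of `⟨ 𝕚 *ₗ x , z ⟩` is minus the imaginary part of `⟨ x , z ⟩`.
  ⊥-from-real : ∀ {x z} → ⟪ x , z ⟫ ℝ.≈ 0# → ⟪ 𝕚 *ₗ x , z ⟫ ℝ.≈ 0# → x ⊥ z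
  ⊥-from-real {x} {z} p q = p , ℝ.trans (ℝ.sym (-‿involutive _)) (ℝ.trans (ℝ.-‿cong (ℝ.trans (ℝ.sym i-part) q)) -0#≈0#)
    where
    open RingProperties ℝ.ring using (-0#≈0#; -‿involutive)
    i-part : ⟪ 𝕚 *ₗ x , z ⟫ ℝ.≈ ℝ.- Im ⟨ x , z ⟩
    i-part = ℝ.trans (proj₁ (⟨⟩-*ˡ 𝕚 x z))
      (ℝ.trans (ℝ.+-cong (ℝ.zeroˡ _) (ℝ.-‿cong (ℝ.*-identityˡ _))) (ℝ.+-identityˡ _))

  span : Pred Carrierᴹ ℓ → Subspace
  span S = record
    { member = Span S
    ; respects = λ p (n , v , v∈S , a , x≈) → n , v , v∈S , a , ≈ᴹ-trans (≈ᴹ-sym p) x≈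
    ; 0-closed = 0 , (λ ()) , (λ ()) , (λ ()) , ≈ᴹ-refl
    ; +-closed = λ { (n , v , v∈S , a , x≈) y∈ → resp (≈ᴹ-sym (+ᴹ-congʳ x≈)) (sums v v∈S a y∈) }
    ; *ₗ-closed = λ { c (n , v , v∈S , a , x≈) → resp (≈ᴹ-sym (*ₗ-congˡ x≈)) (scalings c v v∈S a) }
    }
    where
    resp : ∀ {x y} → x ≈ᴹ y → x ∈ Span S → y ∈ Span S
    resp p (n , v , v∈S , a , x≈) = n , v , v∈S , a , ≈ᴹ-trans (≈ᴹ-sym p) x≈
    cons : ∀ c {s y} → s ∈ S → y ∈ Span S → c *ₗ s +ᴹ y ∈ Span S
    cons c {s} s∈S (n , v , v∈S , a , y≈) =
      suc n , s ∷ v , (λ { zero → s∈S ; (suc i) → v∈S i }) , c ∷ a , +ᴹ-congˡ y≈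
    sums : ∀ {n} (v : Vector Carrierᴹ n) → (∀ i → v i ∈ S) → ∀ a {y} → y ∈ Span S →
           linearCombination a v +ᴹ y ∈ Span S
    sums {zero}  v v∈S a y∈ = resp (≈ᴹ-sym (+ᴹ-identityˡ _)) y∈
    sums {suc n} v v∈S a y∈ = resp (≈ᴹ-sym (+ᴹ-assoc _ _ _))
      (cons (a zero) (v∈S zero) (sums (v ∘ suc) (v∈S ∘ suc) (a ∘ suc) y∈))
    scalings : ∀ c {n} (v : Vector Carrierᴹ n) → (∀ i → v i ∈ S) → ∀ a → c *ₗ linearCombination a v ∈ Span S
    scalings c {zero}  v v∈S a = resp (≈ᴹ-sym (*ₗ-zeroʳ c)) (0 , (λ ()) , (λ ()) , (λ ()) , ≈ᴹ-refl)
    scalings c {suc n} v v∈S a = resp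
      (≈ᴹ-trans (+ᴹ-congʳ (*ₗ-assoc c _ _)) (≈ᴹ-sym (*ₗ-distribˡ c _ _)))
      (cons (c ℂ.* a zero) (v∈S zero) (scalings c (v ∘ suc) (v∈S ∘ suc) (a ∘ suc)))

  span-⊇ : ∀ {S s} → s ∈ S → s ∈ Span S
  span-⊇ {S} {s} s∈S = 1 , (λ _ → s) , (λ _ → s∈S) , (λ _ → 1ℂ) ,
    ≈ᴹ-sym (≈ᴹ-trans (+ᴹ-identityʳ _) (*ₗ-identityˡ s))

  span-least : ∀ {S} V → S ⊆ member V → Span S ⊆ member V
  span-least V S⊆V (n , v , v∈S , a , x≈) = respects V (≈ᴹ-sym x≈) (combination-∈ V a v (S⊆V ∘ v∈S))

  closedSpan-resp : ∀ S {x y} → x ≈ᴹ y → x ∈ ClosedSpan S → y ∈ ClosedSpan S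
  closedSpan-resp S p f ε 0<ε =
    let (y , y∈ , (within , ≉)) = f ε 0<ε
        e = ⟪⟫-cong (+ᴹ-congʳ p) (+ᴹ-congʳ p)
    in y , y∈ , (ℝ.≤-respˡ-≈ e within , λ q → ≉ (ℝ.trans e q))

  span⊆closedSpan : ∀ {S} → Span S ⊆ ClosedSpan S
  span⊆closedSpan {S} {x} x∈ ε 0<ε = x , x∈ ,
    ℝ.≤-<-trans (ℝ.≤-reflexive (proj₁ (respects (perp _) (≈ᴹ-sym (-ᴹ‿inverseʳ x)) (0-closed (perp _))))) (square-pos 0<ε)

  ⊆closedSpan : ∀ S {s} → s ∈ S → s ∈ ClosedSpan S
  ⊆closedSpan S s∈S = span⊆closedSpan {S} (span-⊇ {S} s∈S)

  -- A nearby `y` in `Span S` is orthogonal to `z`, so `⟪ x , z ⟫` equals `⟪ x -ᴹ y , z ⟫`, which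
  -- Cauchy-Schwarz makes small; the same is done for `𝕚 *ₗ z`.
  closedSpan-⊥ : ∀ {S z} → (∀ {s} → s ∈ S → s ⊥ z) → ∀ {x} → x ∈ ClosedSpan S → x ⊥ z
  closedSpan-⊥ {S} {z} S⊥z {x} x∈ = ⊥-sym (⊥-from-real (real S⊥z) (real (λ s∈S →
    ⊥-sym (*ₗ-closed (perp _) 𝕚 (⊥-sym (S⊥z s∈S))))))
    where
    open RingProperties ℝ.ring using (-0#≈0#)
    real : ∀ {z} → (∀ {s} → s ∈ S → s ⊥ z) → ⟪ z , x ⟫ ℝ.≈ 0#
    real {z} S⊥z = ℝ.trans (⟪⟫-sym z x) (zero-from-ε (⟨⟩-nonNeg z) λ ε 0<ε →
      let (y , y∈ , within) = x∈ ε 0<ε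
          y⊥z = span-least (perp z) S⊥z y∈
          e : ⟪ x , z ⟫ ℝ.≈ ⟪ x -ᴹ y , z ⟫
          e = ℝ.sym (ℝ.trans (⟪⟫--ˡ x y z) (ℝ.trans (ℝ.+-congˡ (ℝ.trans (ℝ.-‿cong (proj₁ y⊥z)) -0#≈0#))
                (ℝ.+-identityʳ _)))
      in ℝ.≤-respˡ-≈ (ℝ.*-cong (ℝ.sym e) (ℝ.sym e)) (ℝ.≤-trans (cauchy-schwarz (x -ᴹ y) z)
           (ℝ.≤-respˡ-≈ (ℝ.*-comm _ _) (ℝ.*-monoʳ-≤ (⟨⟩-nonNeg z) (proj₁ within)))))

  <-+ : ∀ {d e} → 0# < e → d < d + e
  <-+ {d} {e} p = ℝ.<-by p (solve 2 (λ d e → d :+ e :- d := e) ℝ.refl d e)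

  cancel-- : ∀ a b c → (a - c) - (a - b) ℝ.≈ b - c
  cancel-- = solve 3 (λ a b c → (a :- c) :- (a :- b) := b :- c) ℝ.refl

  telescope : ∀ a b c → (a - b) + (b - c) ℝ.≈ a - c
  telescope = solve 3 (λ a b c → (a :- b) :+ (b :- c) := a :- c) ℝ.refl

  -- In the Cauchy estimate `q` is a squared norm, written as a difference of two inner products
  -- that are each controlled by `q` itself; one factor `q` cancels.
  a-b-estimate : ∀ {a b δ δ′ q} → 0# < q → q ℝ.≈ a - b → a * a ≤ δ * q → b * b ≤ δ′ * q → q ≤ (δ + δ) + (δ′ + δ′)
  a-b-estimate {a} {b} {δ} {δ′} {q} 0<q q≈ α² β² = ℝ.*-cancelˡ-≤ 0<q
    (ℝ.≤-respˡ-≈ (ℝ.*-cong (ℝ.sym q≈) (ℝ.sym q≈)) (ℝ.≤-trans (square-+-≤ a (ℝ.- b))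
      (ℝ.≤-respʳ-≈ (solve 3 (λ δ δ′ q → (δ :* q :+ δ :* q) :+ (δ′ :* q :+ δ′ :* q) := q :* ((δ :+ δ) :+ (δ′ :+ δ′))) ℝ.refl δ δ′ q)
        (ℝ.+-mono-≤ (ℝ.+-mono-≤ α² α²) (ℝ.+-mono-≤ β²′ β²′)))))
    where
    β²′ : (ℝ.- b) * (ℝ.- b) ≤ δ′ * q
    β²′ = ℝ.≤-respˡ-≈ (solve 1 (λ b → b :* b := :- b :* :- b) ℝ.refl b) β²

  a+b-estimate : ∀ {c a b e q} → c ℝ.≈ a + b → a * a ≤ q * e → b * b ≤ q * e → c * c ≤ ((q + q) + (q + q)) * e
  a+b-estimate {c} {a} {b} {e} {q} c≈ α² β² = ℝ.≤-respˡ-≈ (ℝ.*-cong (ℝ.sym c≈) (ℝ.sym c≈))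
    (ℝ.≤-trans (square-+-≤ a b)
      (ℝ.≤-respʳ-≈ (solve 2 (λ q e → (q :* e :+ q :* e) :+ (q :* e :+ q :* e) := ((q :+ q) :+ (q :+ q)) :* e) ℝ.refl q e)
        (ℝ.+-mono-≤ (ℝ.+-mono-≤ α² α²) (ℝ.+-mono-≤ β² β²))))

  -- Division by five rather than four makes the inequality strict.
  quarter : ∀ {x} → 0# < x → ∃[ η ] (0# < η × (η + η) + (η + η) < x)
  quarter {x} 0<x =
    let (i , 0<i , 5i≈1) = ℝ.pos-inverse (ℝ.+-pos ℝ.0<1 (ℝ.+-nonNeg (ℝ.+-nonNeg ℝ.0≤1 ℝ.0≤1) (ℝ.+-nonNeg ℝ.0≤1 ℝ.0≤1)))
    in x * i , ℝ.*-pos 0<x 0<i , ℝ.<-by (ℝ.*-pos 0<x 0<i) (difference i 5i≈1)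
    where
    o = ℝ.1#
    difference : ∀ i → (o + ((o + o) + (o + o))) * i ℝ.≈ o →
      x - ((x * i + x * i) + (x * i + x * i)) ℝ.≈ x * i
    difference i 5i≈1 = begin
      x - ((x * i + x * i) + (x * i + x * i))
        ≈⟨ ℝ.+-congʳ (ℝ.trans (ℝ.sym (ℝ.*-identityʳ _)) (ℝ.*-congˡ (ℝ.sym 5i≈1))) ⟩
      x * ((o + ((o + o) + (o + o))) * i) - ((x * i + x * i) + (x * i + x * i))
        ≈⟨ ℝ.+-congʳ (solve 3 (λ x o i → x :* ((o :+ ((o :+ o) :+ (o :+ o))) :* i)
             := o :* (x :* i) :+ ((o :* (x :* i) :+ o :* (x :* i)) :+ (o :* (x :* i) :+ o :* (x :* i)))) ℝ.refl x o i) ⟩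
      o * (x * i) + ((o * (x * i) + o * (x * i)) + (o * (x * i) + o * (x * i))) - ((x * i + x * i) + (x * i + x * i))
        ≈⟨ ℝ.+-congʳ (let p = ℝ.*-identityˡ (x * i) in ℝ.+-cong p (ℝ.+-cong (ℝ.+-cong p p) (ℝ.+-cong p p))) ⟩
      x * i + ((x * i + x * i) + (x * i + x * i)) - ((x * i + x * i) + (x * i + x * i))
        ≈⟨ solve 1 (λ η → η :+ ((η :+ η) :+ (η :+ η)) :- ((η :+ η) :+ (η :+ η)) := η) ℝ.refl (x * i) ⟩
      x * i ∎
      where open SetoidReasoning ℝ.setoid

  -- Minimising sequences for the distance to a span

  module _ (S : Pred Carrierᴹ ℓ) (x : Carrierᴹ) where

    IsMinimising : RealNumbers.Carrier ℝ → (ℕ → Carrierᴹ) → Set ℓ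
    IsMinimising d s = (∀ y → y ∈ Span S → d ≤ ‖ x -ᴹ y ‖²) ×
                       (∀ n → s n ∈ Span S × ‖ x -ᴹ s n ‖² ≤ d + ℝ.1/ n)

    -- The infimum of the squared distances is the supremum of their lower bounds. Excluded middle
    -- applied to the existential in `near` also selects the sequence.
    minimising-sequence : ∃[ d ] ∃[ s ] IsMinimising d s
    minimising-sequence = d , (λ n → proj₁ (near n)) ,
      (λ y y∈ → proj₂ (proj₂ infimum) ‖ x -ᴹ y ‖² (λ r f → f y y∈)) , (λ n → proj₂ (near n))
      where
      bounds : Pred (RealNumbers.Carrier ℝ) ℓ
      bounds r = ∀ y → y ∈ Span S → r ≤ ‖ x -ᴹ y ‖²
      infimum : ∃[ d ] (ℝ.IsUpperBound bounds d × (∀ b → ℝ.IsUpperBound bounds b → d ≤ b))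
      infimum = ℝ.supremum bounds (0# , λ y _ → ⟨⟩-nonNeg _)
        (‖ x -ᴹ 0ᴹ ‖² , λ r f → f 0ᴹ (0-closed (span S)))
      d = proj₁ infimum
      near : ∀ n → ∃[ y ] (y ∈ Span S × ‖ x -ᴹ y ‖² ≤ d + ℝ.1/ n)
      near n = decidable-stable em λ none → ℝ.<⇒≱ (<-+ (ℝ.1/-pos n))
        (proj₁ (proj₂ infimum) (d + ℝ.1/ n) λ y y∈ →
          proj₁ (ℝ.≰⇒> λ close → none (y , y∈ , close)))

    module _ {d : RealNumbers.Carrier ℝ} {s : ℕ → Carrierᴹ} (minimising : IsMinimising d s) where
      private
        s∈ : ∀ n → s n ∈ Span S
        s∈ n = proj₁ (proj₂ minimising n)

      almost-⊥ : ∀ n {w} → w ∈ Span S → ⟪ x -ᴹ s n , w ⟫ * ⟪ x -ᴹ s n , w ⟫ ≤ ℝ.1/ n * ‖ w ‖²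
      almost-⊥ n {w} w∈ = variational (x -ᴹ s n) w (proj₂ (proj₂ minimising n)) λ t →
        ℝ.≤-respʳ-≈ (let e = ≈ᴹ-trans (+ᴹ-congˡ (≈ᴹ-sym (-ᴹ-+ᴹ-comm (s n) _))) (≈ᴹ-sym (+ᴹ-assoc x _ _)) in ⟪⟫-cong e e)
          (proj₁ minimising (s n +ᴹ (t , 0#) *ₗ w) (+-closed (span S) (s∈ n) (*ₗ-closed (span S) (t , 0#) w∈)))

      -- For `w = s m -ᴹ s n`, `‖ w ‖²` is `⟪ x -ᴹ s n , w ⟫ - ⟪ x -ᴹ s m , w ⟫`, and both terms are
      -- small by `almost-⊥`. This takes the place of the parallelogram law.
      ‖sm-sn‖²≤ : ∀ m n → ‖ s m -ᴹ s n ‖² ≤ (ℝ.1/ n + ℝ.1/ n) + (ℝ.1/ m + ℝ.1/ m)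
      -- Failure of the bound supplies the positivity of `‖ w ‖²` that is needed to cancel it.
      ‖sm-sn‖²≤ m n = decidable-stable em λ far → far
        (a-b-estimate
          (ℝ.≤-<-trans (ℝ.+-nonNeg (ℝ.+-nonNeg (proj₁ (ℝ.1/-pos n)) (proj₁ (ℝ.1/-pos n)))
                                   (ℝ.+-nonNeg (proj₁ (ℝ.1/-pos m)) (proj₁ (ℝ.1/-pos m)))) (ℝ.≰⇒> far))
          (ℝ.trans (⟪⟫--ˡ (s m) (s n) w)
            (ℝ.trans (ℝ.sym (cancel-- ⟪ x , w ⟫ ⟪ s m , w ⟫ ⟪ s n , w ⟫))
              (ℝ.sym (ℝ.+-cong (⟪⟫--ˡ x (s n) w) (ℝ.-‿cong (⟪⟫--ˡ x (s m) w))))))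
          (almost-⊥ n w∈) (almost-⊥ m w∈))
        where
        w = s m -ᴹ s n
        w∈ = +-closed (span S) (s∈ m) (neg-closed (span S) (s∈ n))

      minimising⇒cauchy : IsCauchy s
      minimising⇒cauchy ε 0<ε =
        let (η , 0<η , 4η<ε²) = quarter (square-pos 0<ε)
            (N , small) = ℝ.1/-small η 0<η
        in N , λ m n N≤m N≤n → ℝ.≤-<-trans
             (ℝ.≤-trans (‖sm-sn‖²≤ m n) (ℝ.+-mono-≤ (ℝ.+-mono-≤ (small n N≤n) (small n N≤n)) (ℝ.+-mono-≤ (small m N≤m) (small m N≤m))))
             4η<ε²

      module _ {m : Carrierᴹ} (limit : ConvergesTo s m) where

        limit-∈ : m ∈ ClosedSpan S
        limit-∈ ε 0<ε =
          let (N , within) = limit ε 0<ε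
              (p , ≉) = within N ℕ.≤-refl
              e = ‖-‖²-sym (s N) m
          in s N , s∈ N , (ℝ.≤-respˡ-≈ e p , λ q → ≉ (ℝ.trans e q))

        -- `x -ᴹ m` is split at `s n`: `almost-⊥` handles `x -ᴹ s n`, and Cauchy-Schwarz handles
        -- `s n -ᴹ m`.
        limit-⊥ : ∀ {w} → w ∈ Span S → ⟪ w , x -ᴹ m ⟫ ℝ.≈ 0#
        limit-⊥ {w} w∈ = ℝ.trans (⟪⟫-sym w _) (zero-from-ε {q = (q + q) + (q + q)} (ℝ.+-nonNeg 0≤2q 0≤2q) λ ε 0<ε →
          let (N , within) = limit ε 0<ε
              (N′ , small) = ℝ.1/-small (ε * ε) (square-pos 0<ε)
              n = N ℕ.⊔ N′
          in a+b-estimate {q = q}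
               (ℝ.trans (⟪⟫--ˡ x m w) (ℝ.trans (ℝ.sym (telescope ⟪ x , w ⟫ ⟪ s n , w ⟫ ⟪ m , w ⟫))
                 (ℝ.sym (ℝ.+-cong (⟪⟫--ˡ x (s n) w) (⟪⟫--ˡ (s n) m w)))))
               (ℝ.≤-trans (almost-⊥ n w∈) (ℝ.≤-respˡ-≈ (ℝ.*-comm q _) (ℝ.*-monoʳ-≤ 0≤q (small n (ℕ.m≤n⊔m N N′)))))
               (ℝ.≤-trans (cauchy-schwarz (s n -ᴹ m) w)
                 (ℝ.≤-respˡ-≈ (ℝ.*-comm q _) (ℝ.*-monoʳ-≤ 0≤q (proj₁ (within n (ℕ.m≤m⊔n N N′)))))))
          where
          q = ‖ w ‖²
          0≤q = ⟨⟩-nonNeg w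
          0≤2q = ℝ.+-nonNeg 0≤q 0≤q

    projection : ∃[ m ] (m ∈ ClosedSpan S × ∀ {s} → s ∈ S → s ⊥ (x -ᴹ m))
    projection =
      let (d , s , minimising) = minimising-sequence
          (m , limit) = complete s (minimising⇒cauchy minimising)
      in m , limit-∈ minimising limit , λ s∈S → ⊥-from-real
           (limit-⊥ minimising limit (span-⊇ s∈S))
           (limit-⊥ minimising limit (*ₗ-closed (span S) 𝕚 (span-⊇ s∈S)))

-- Compatibility as orthogonality over the intersection

module Compatibility (em : ∀ {a} → ExcludedMiddle a) (zorn : ∀ {c ℓ₁ ℓ₂} → ZornsLemma c ℓ₁ ℓ₂)
                     {ℓ} {ℝ : RealNumbers ℓ} (H : HilbertSpace ℝ) where
  open HilbertSpace H
  open Subspaces H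
  open Orthogonality em H
  open Dimension em H
  open ProjectionTheorem em H
  private
    module ℝ where
      open RealNumbers ℝ public
      open RealProperties em ℝ public
    module ℂ = CommutativeRing ℂ-commutativeRing

  -- X splits along X ∩ Y, so it is enough to require orthogonality to X ∩ Y of
  -- y alone.
  OrthogonalOverMeet : Subspace → Subspace → Set ℓ
  OrthogonalOverMeet X Y = ∀ {y} → y ∈ member Y → y ∈ member ((member X ∩ member Y) ^⊥) →
    ∀ {x} → x ∈ member X → x ⊥ y

  -- A vector of `S` either occurs in `T`, hence lies in `X ∩ Y` and is orthogonal to `y`, or is
  -- orthogonal to all of `T` and so to `Y`. This passes from `S` to its closed span `X`.
  compatible⇒orthogonal : ∀ X Y → Compatible X Y → OrthogonalOverMeet X Y
  compatible⇒orthogonal X Y (B , (_ , orthogonal , _) , (S , S⊆B , X⊆S , S⊆X) , (T , T⊆B , Y⊆T , T⊆Y)) {y} y∈Y y⊥ x∈X =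
    closedSpan-⊥ S⊥y (X⊆S x∈X)
    where
    S⊥y : ∀ {s} → s ∈ S → s ⊥ y
    S⊥y {s} s∈S with em {P = ∃[ t ] (t ∈ T × s ≈ᴹ t)}
    ... | yes (t , t∈T , s≈t) = ⊥-sym (y⊥ s
            (S⊆X (⊆closedSpan S s∈S) , respects Y (≈ᴹ-sym s≈t) (T⊆Y (⊆closedSpan T t∈T))))
    ... | no none = ⊥-sym (closedSpan-⊥
            (λ {t} t∈T → ⊥-sym (orthogonal s t (S⊆B s∈S) (T⊆B t∈T) (λ s≈t → none (t , t∈T , s≈t)))) (Y⊆T y∈Y))

  Orthonormal : Pred Carrierᴹ ℓ → Set ℓ
  Orthonormal B = (∀ x → x ∈ B → ⟨ x , x ⟩ ≈ℂ 1ℂ) × (∀ x y → x ∈ B → y ∈ B → ¬ x ≈ᴹ y → x ⊥ y)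

  IsTotalIn : Pred Carrierᴹ ℓ → Pred Carrierᴹ ℓ → Set ℓ
  IsTotalIn V S = ∀ {x} → x ∈ V → (∀ {s} → s ∈ S → s ⊥ x) → x ≈ᴹ 0ᴹ

  orthonormal-∪ : ∀ {S T} → Orthonormal S → Orthonormal T → (∀ {s t} → s ∈ S → t ∈ T → s ⊥ t) → Orthonormal (S ∪ T)
  orthonormal-∪ (unitS , orthS) (unitT , orthT) S⊥T =
    (λ x → [ unitS x , unitT x ]′) ,
    λ { x y (inj₁ p) (inj₁ q) x≉y → orthS x y p q x≉y
      ; x y (inj₁ p) (inj₂ q) x≉y → S⊥T p q
      ; x y (inj₂ p) (inj₁ q) x≉y → ⊥-sym (S⊥T q p)
      ; x y (inj₂ p) (inj₂ q) x≉y → orthT x y p q x≉y }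

  normalise : ∀ {u} → ¬ u ≈ᴹ 0ᴹ → ∃[ c ] ⟨ c *ₗ u , c *ₗ u ⟩ ≈ℂ 1ℂ
  normalise {u} u≉0 =
    let (i , 0<i , qi≈1) = ℝ.pos-inverse (⟨⟩-nonNeg u , λ e → u≉0 (‖‖²-definite (ℝ.sym e)))
        (t , _ , t²≈i) = ℝ.sqrt i (proj₁ 0<i)
    in (t , 0#) , ℂ.trans (⟨x,x⟩≈‖x‖² _)
         (ℝ.trans (‖‖²-scale t u) (ℝ.trans (ℝ.*-congʳ t²≈i) (ℝ.trans (ℝ.*-comm i _) qi≈1)) , ℝ.refl)

  -- Sets of vectors need not respect `≈ᴹ`, so propositional equality can define the singleton.
  unit-singleton : ∀ {v} → ⟨ v , v ⟩ ≈ℂ 1ℂ → Orthonormal (_≡ v)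
  unit-singleton unit = (λ { _ ≡.refl → unit }) , λ { _ _ ≡.refl ≡.refl v≉v → ⊥-elim (v≉v ≈ᴹ-refl) }

  orthonormal-basis : ∀ {n} V → Dim V n →
    ∃[ S ] (Orthonormal S × S ⊆ member V × IsTotalIn (member V) S)
  orthonormal-basis {zero}  V D = (λ _ → ⊥ᵖ) , ((λ _ ()) , λ _ _ ()) , (λ ()) , λ x∈V _ → D _ x∈V
  orthonormal-basis {suc n} V (u , u∈V , u≉0 , D) =
    add (proj₁ (normalise u≉0)) (proj₂ (normalise u≉0)) (orthonormal-basis (V ⊓ perp u) D)
    where
    unscale : ∀ c → ⟨ c *ₗ u , c *ₗ u ⟩ ≈ℂ 1ℂ → ∃[ d ] u ≈ᴹ d *ₗ (c *ₗ u)
    unscale c unit = multiple-sym (λ cu≈0 → 1≉0 (ℂ.trans (ℂ.sym unit)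
      (respects (perp _) (≈ᴹ-sym cu≈0) (0-closed (perp _))))) ≈ᴹ-refl
    add : ∀ c → ⟨ c *ₗ u , c *ₗ u ⟩ ≈ℂ 1ℂ →
      ∃[ S ] (Orthonormal S × S ⊆ member (V ⊓ perp u) × IsTotalIn (member (V ⊓ perp u)) S) →
      ∃[ S ] (Orthonormal S × S ⊆ member V × IsTotalIn (member V) S)
    add c unit (S , orthonormal , S⊆ , total) =
      (_≡ c *ₗ u) ∪ S ,
      orthonormal-∪ (unit-singleton unit) orthonormal
        (λ { ≡.refl s∈S → *ₗ-closed (perp _) c (⊥-sym (proj₂ (S⊆ s∈S))) }) ,
      (λ { (inj₁ ≡.refl) → *ₗ-closed V c u∈V ; (inj₂ s∈S) → proj₁ (S⊆ s∈S) }) ,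
      λ {x} x∈V ⊥x → total (x∈V , x⊥u x (⊥x (inj₁ ≡.refl))) (⊥x ∘ inj₂)
      where
      x⊥u : ∀ x → c *ₗ u ⊥ x → x ⊥ u
      x⊥u x cu⊥x = let (d , u≈dcu) = unscale c unit in
        ⊥-sym (respects (perp x) (≈ᴹ-sym u≈dcu) (*ₗ-closed (perp x) d cu⊥x))

  -- A vector orthogonal to `A` has zero projection to `C`, so it lies in the orthogonal complement
  -- of `C` in `V`, where `B` is total.
  total-∪ : ∀ {n A B} V C → Dim C n → A ⊆ member C → IsTotalIn (member C) A →
    IsTotalIn (member (V ⊓ (member C ^⊥))) B → member C ⊆ member V → IsTotalIn (member V) (A ∪ B)
  total-∪ V C D A⊆C totalA totalB C⊆V {x} x∈V ⊥x =
    let (p , r , x≈p+r , p∈C , r⊥C) = project C D x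
        p≈0 = totalA p∈C λ {a} a∈A →
          ⊥-sym (∈-remainderˡ (perp a) x≈p+r (⊥-sym (⊥x (inj₁ a∈A))) (r⊥C a (A⊆C a∈A)))
        r≈x = ≈ᴹ-sym (≈ᴹ-trans x≈p+r (≈ᴹ-trans (+ᴹ-congʳ p≈0) (+ᴹ-identityˡ r)))
    in totalB (x∈V , λ s s∈C → respects (perp s) r≈x (r⊥C s s∈C)) (⊥x ∘ inj₂)

  x-y≈0⇒x≈y : ∀ {x y} → x -ᴹ y ≈ᴹ 0ᴹ → x ≈ᴹ y
  x-y≈0⇒x≈y = x∙y⁻¹≈ε⇒x≈y _ _
    where open import Algebra.Properties.AbelianGroup +ᴹ-abelianGroup using (x∙y⁻¹≈ε⇒x≈y)

  -- Finite-dimensional subspaces are closed: the part `r` of a limit orthogonal to `V` is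
  -- orthogonal to itself. Conversely, projecting `x` to the closed span leaves a rest in `V`
  -- orthogonal to `S`, which totality makes zero.
  total⇒closedSpan : ∀ {n S} V → Dim V n → S ⊆ member V → IsTotalIn (member V) S → member V ≐ ClosedSpan S
  total⇒closedSpan {S = S} V D S⊆V total = V⊆ , ⊆V
    where
    ⊆V : ClosedSpan S ⊆ member V
    ⊆V {x} x∈ =
      let (p , r , x≈p+r , p∈V , r⊥V) = project V D x
          x⊥r = closedSpan-⊥ (λ {s} s∈S → ⊥-sym (r⊥V s (S⊆V s∈S))) x∈
          r≈0 = ⊥-self (∈-remainder (perp r) x≈p+r x⊥r (⊥-sym (r⊥V p p∈V)))
      in respects V (≈ᴹ-sym (≈ᴹ-trans x≈p+r (≈ᴹ-trans (+ᴹ-congˡ r≈0) (+ᴹ-identityʳ p)))) p∈V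
    V⊆ : member V ⊆ ClosedSpan S
    V⊆ {x} x∈V =
      let (m , m∈ , S⊥x-m) = projection S x
      in closedSpan-resp S (≈ᴹ-sym (x-y≈0⇒x≈y (total (+-closed V x∈V (neg-closed V (⊆V m∈))) S⊥x-m))) m∈

  -- Extension to an orthonormal basis by Zorn's lemma

  record OrthonormalExtension (R : Pred Carrierᴹ ℓ) : Set (lsuc ℓ) where
    field
      set         : Pred Carrierᴹ ℓ
      orthonormal : Orthonormal set
      extends     : R ⊆ set

  open OrthonormalExtension

  extensions : Pred Carrierᴹ ℓ → Poset (lsuc ℓ) ℓ ℓ
  extensions R = record
    { Carrier = OrthonormalExtension R
    ; _≈_ = λ A B → set A ≐ set B
    ; _≤_ = λ A B → set A ⊆ set B
    ; isPartialOrder = record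
      { isPreorder = record
        { isEquivalence = record { refl = ≐-refl ; sym = ≐-sym ; trans = ≐-trans }
        ; reflexive = proj₁
        ; trans = λ p q → q ∘ p
        }
      ; antisym = _,_
      }
    }

  maximal-extension : ∀ {R} → Orthonormal R → ∃[ B ] IsMaximal (extensions R) B
  maximal-extension {R} orthonormalR = zorn (extensions R) λ C chain → union C chain , λ A A∈C x∈A →
      lift (fromWitness (inj₂ (A , A∈C , x∈A)))
    where
    module _ (C : Pred (OrthonormalExtension R) ℓ) (chain : IsChain (extensions R) C) where
      -- Including `R` makes the union an upper bound in the poset even for the empty chain.
      InUnion : Pred Carrierᴹ (lsuc ℓ)
      InUnion x = x ∈ R ⊎ ∃[ A ] (A ∈ C × x ∈ set A)

      -- Excluded middle resizes the union, which quantifies over sets, to level ℓ.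
      resized : Pred Carrierᴹ ℓ
      resized x = Lift ℓ (True (em {P = InUnion x}))

      -- Orthonormality concerns at most two vectors at a time, and these already lie together in
      -- one orthonormal set.
      common : ∀ {x y} → InUnion x → InUnion y → ∃[ A ] (Orthonormal A × x ∈ A × y ∈ A)
      common (inj₁ p) (inj₁ q) = R , orthonormalR , p , q
      common (inj₁ p) (inj₂ (A , _ , q)) = set A , orthonormal A , extends A p , q
      common (inj₂ (A , _ , p)) (inj₁ q) = set A , orthonormal A , p , extends A q
      common (inj₂ (A , A∈C , p)) (inj₂ (B , B∈C , q)) with chain A∈C B∈C
      ... | inj₁ A⊆B = set B , orthonormal B , A⊆B p , q
      ... | inj₂ B⊆A = set A , orthonormal A , p , B⊆A q

      union : OrthonormalExtension R
      union = record
        { set = resized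
        ; orthonormal =
            (λ x p → let (A , (unit , _) , q , _) = common (toWitness (lower p)) (toWitness (lower p)) in unit x q) ,
            (λ x y p q → let (A , (_ , orth) , p′ , q′) = common (toWitness (lower p)) (toWitness (lower q)) in orth x y p′ q′)
        ; extends = λ p → lift (fromWitness (inj₁ p))
        }

  -- A nonzero vector orthogonal to a maximal set could be normalised and added. With no such vector
  -- left, the projection theorem makes the closed span all of `H`.
  extend-to-basis : ∀ {R} → Orthonormal R → ∃[ B ] (IsOrthonormalBasis B × R ⊆ B)
  extend-to-basis {R} orthonormalR = from (maximal-extension orthonormalR)
    where
    from : ∃[ B ] IsMaximal (extensions R) B → ∃[ B ] (IsOrthonormalBasis B × R ⊆ B)
    from (B , maximal) = set B , (proj₁ (orthonormal B) , proj₂ (orthonormal B) , dense) , extends B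
      where
      total : ∀ {z} → (∀ {s} → s ∈ set B → s ⊥ z) → z ≈ᴹ 0ᴹ
      total {z} B⊥z = decidable-stable em λ z≉0 →
        let (c , unit) = normalise z≉0
            v = c *ₗ z
            B⊥v : ∀ {s} → s ∈ set B → s ⊥ v
            B⊥v s∈B = ⊥-sym (*ₗ-closed (perp _) c (⊥-sym (B⊥z s∈B)))
            larger = record
              { set = set B ∪ (_≡ v)
              ; orthonormal = orthonormal-∪ (orthonormal B) (unit-singleton unit) (λ { s∈B ≡.refl → B⊥v s∈B })
              ; extends = inj₁ ∘ extends B
              }
            v∈B = proj₁ (maximal larger inj₁) (inj₂ ≡.refl)
        in 1≉0 (ℂ.trans (ℂ.sym unit) (B⊥v v∈B))
      dense : ∀ x → x ∈ ClosedSpan (set B)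
      dense x =
        let (m , m∈ , ⊥x-m) = projection (set B) x
        in closedSpan-resp (set B) (≈ᴹ-sym (x-y≈0⇒x≈y (total ⊥x-m))) m∈

  orthogonal⇒compatible : ∀ {m n} X Y → Dim X m → Dim Y n → OrthogonalOverMeet X Y → Compatible X Y
  orthogonal⇒compatible X Y DX DY X⊥Y =
    let C = X ⊓ Y
        (_ , DC) = Dim-sub C X proj₁ DX
        X′ = X ⊓ (member C ^⊥)
        Y′ = Y ⊓ (member C ^⊥)
        (A , orthonormalA , A⊆ , totalA) = orthonormal-basis C DC
        (S , orthonormalS , S⊆ , totalS) = orthonormal-basis X′ (proj₂ (Dim-sub X′ X proj₁ DX))
        (T , orthonormalT , T⊆ , totalT) = orthonormal-basis Y′ (proj₂ (Dim-sub Y′ Y proj₁ DY))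
        S⊥T = λ {s} {t} (s∈S : s ∈ S) (t∈T : t ∈ T) →
          X⊥Y (proj₁ (T⊆ t∈T)) (proj₂ (T⊆ t∈T)) (proj₁ (S⊆ s∈S))
        orthonormalR = orthonormal-∪ orthonormalA (orthonormal-∪ orthonormalS orthonormalT S⊥T)
          (λ { a∈A (inj₁ s∈S) → ⊥-sym (proj₂ (S⊆ s∈S) _ (A⊆ a∈A))
             ; a∈A (inj₂ t∈T) → ⊥-sym (proj₂ (T⊆ t∈T) _ (A⊆ a∈A)) })
        (B , basis , R⊆B) = extend-to-basis orthonormalR
    in B , basis ,
       (A ∪ S , R⊆B ∘ [ inj₁ , inj₂ ∘ inj₁ ]′ ,
         total⇒closedSpan X DX [ proj₁ ∘ A⊆ , proj₁ ∘ S⊆ ]′ (total-∪ X C DC A⊆ totalA totalS proj₁)) ,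
       (A ∪ T , R⊆B ∘ [ inj₁ , inj₂ ∘ inj₂ ]′ ,
         total⇒closedSpan Y DY [ proj₂ ∘ A⊆ , proj₁ ∘ T⊆ ]′ (total-∪ Y C DC A⊆ totalA totalT proj₂))

-- Intersections along an edge

module Geodesics (em : ∀ {a} → ExcludedMiddle a) (zorn : ∀ {c ℓ₁ ℓ₂} → ZornsLemma c ℓ₁ ℓ₂)
                 {ℓ} {ℝ : RealNumbers ℓ} (H : HilbertSpace ℝ) where
  open HilbertSpace H
  open Subspaces H
  open Orthogonality em H
  open Dimension em H
  open Compatibility em zorn H

  -- Otherwise every vector of `V` would equal its projection to `U`, against the dimensions.
  proper-complement : ∀ {m n} U V → member U ⊆ member V → Dim U m → Dim V n → m ℕ.< n →
    ∃[ r ] (r ∈ member V × r ∈ member (member U ^⊥) × ¬ r ≈ᴹ 0ᴹ)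
  proper-complement U V U⊆V D E m<n = decidable-stable em λ none →
    ℕ.<⇒≱ m<n (Dim-mono V U (λ {v} v∈V →
      let (p , r , v≈p+r , p∈U , r⊥U) = project U D v
          r≈0 = decidable-stable em λ r≉0 → none (r , ∈-remainder V v≈p+r v∈V (U⊆V p∈U) , r⊥U , r≉0)
      in respects U (≈ᴹ-sym (≈ᴹ-trans v≈p+r (≈ᴹ-trans (+ᴹ-congˡ r≈0) (+ᴹ-identityʳ p)))) p∈U) E D)

  hyperplane-complement : ∀ {j v} U V → member U ⊆ member V → Dim U j → Dim V (suc j) →
    v ∈ member V → v ∈ member (member U ^⊥) → ¬ v ≈ᴹ 0ᴹ → member (V ⊓ perp v) ⊆ member U
  hyperplane-complement {v = v} U V U⊆V D E v∈V v⊥U v≉0 =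
    Dim-⊆⇒⊇ U (V ⊓ perp v) (λ {u} u∈U → U⊆V u∈U , ⊥-sym (v⊥U u u∈U)) D (exchange V E v∈V v≉0)

  module _ {j c} (Z Z′ Y : Subspace) (D-meet : Dim (Z ⊓ Z′) j) (D′ : Dim Z′ (suc j)) (Dc : Dim (Z ⊓ Y) c) where

    private
      normal = proper-complement (Z ⊓ Z′) Z′ proj₂ D-meet D′ ℕ.≤-refl
      v = proj₁ normal
      Z′∩v⊥⊆Z : member (Z′ ⊓ perp v) ⊆ member Z
      Z′∩v⊥⊆Z = let (_ , v∈ , v⊥ , v≉0) = normal in
        proj₁ ∘ hyperplane-complement (Z ⊓ Z′) Z′ proj₂ D-meet D′ v∈ v⊥ v≉0

      ⊆v⊥ : member (Z′ ⊓ Y) ⊆ member (perp v) → member (Z′ ⊓ Y) ⊆ member (Z ⊓ Y)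
      ⊆v⊥ f (z∈Z′ , z∈Y) = Z′∩v⊥⊆Z (z∈Z′ , f (z∈Z′ , z∈Y)) , z∈Y

      section⊆ : member ((Z′ ⊓ Y) ⊓ perp v) ⊆ member (Z ⊓ Y)
      section⊆ ((z∈Z′ , z∈Y) , z⊥v) = Z′∩v⊥⊆Z (z∈Z′ , z⊥v) , z∈Y

    -- `v` spans the orthogonal complement of `Z ∩ Z′` in `Z′`, so cutting `Z′ ∩ Y` by `v^⊥` leaves
    -- a subspace of `Z ∩ Y`, and a cut costs at most one dimension.
    meet-bound : ∀ {c′} → Dim (Z′ ⊓ Y) c′ → c′ ℕ.≤ suc c
    meet-bound {zero}   D = ℕ.z≤n
    meet-bound {suc c′} D = bound (hyperplane (Z′ ⊓ Y) v D)
      where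
      bound : member (Z′ ⊓ Y) ⊆ member (perp v) ⊎ Dim ((Z′ ⊓ Y) ⊓ perp v) c′ → suc c′ ℕ.≤ suc c
      bound (inj₁ f) = ℕ.m≤n⇒m≤1+n (Dim-mono (Z′ ⊓ Y) (Z ⊓ Y) (⊆v⊥ f) D Dc)
      bound (inj₂ E) = ℕ.s≤s (Dim-mono ((Z′ ⊓ Y) ⊓ perp v) (Z ⊓ Y) section⊆ E Dc)

    -- When a dimension is gained, the cut of `Z′ ∩ Y` has the dimension of `Z ∩ Y` and is all of
    -- it.
    meet-grows : Dim (Z′ ⊓ Y) (suc c) → member (Z ⊓ Y) ⊆ member Z′
    meet-grows D = grows (hyperplane (Z′ ⊓ Y) v D)
      where
      grows : member (Z′ ⊓ Y) ⊆ member (perp v) ⊎ Dim ((Z′ ⊓ Y) ⊓ perp v) c → member (Z ⊓ Y) ⊆ member Z′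
      grows (inj₁ f) = ⊥-elim (ℕ.1+n≰n (Dim-mono (Z′ ⊓ Y) (Z ⊓ Y) (⊆v⊥ f) D Dc))
      grows (inj₂ E) z∈ = proj₁ (proj₁ (Dim-⊆⇒⊇ ((Z′ ⊓ Y) ⊓ perp v) (Z ⊓ Y) section⊆ E Dc z∈))

    -- The point is that Z′ is (Z ∩ Z′) ⊕ ℂv for some v ∈ Y orthogonal to Z.
    orthogonal-advance : Dim (Z′ ⊓ Y) (suc c) → OrthogonalOverMeet Z Y →
      OrthogonalOverMeet Z Z′ × OrthogonalOverMeet Z′ Y
    orthogonal-advance D Z⊥Y = from
      (proper-complement (Z ⊓ Y) (Z′ ⊓ Y) (λ p → meet-grows D p , proj₂ p) Dc D ℕ.≤-refl)
      where
      from : ∃[ v ] (v ∈ member (Z′ ⊓ Y) × v ∈ member (member (Z ⊓ Y) ^⊥) × ¬ v ≈ᴹ 0ᴹ) →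
             OrthogonalOverMeet Z Z′ × OrthogonalOverMeet Z′ Y
      from (v , (v∈Z′ , v∈Y) , v⊥ , v≉0) = Z⊥Z′ , Z′⊥Y
        where
        Z⊥v : ∀ {z} → z ∈ member Z → z ⊥ v
        Z⊥v = Z⊥Y v∈Y v⊥
        split : ∀ {z} → z ∈ member Z′ → ∃[ a ] ∃[ u ] (z ≈ᴹ a *ₗ v +ᴹ u × u ∈ member (Z ⊓ Z′))
        split {z} z∈Z′ =
          let (a , u , z≈ , u⊥v) = decompose v≉0 z
              u∈Z′ = ∈-remainder Z′ z≈ z∈Z′ (*ₗ-closed Z′ a v∈Z′)
          in a , u , z≈ , hyperplane-complement (Z ⊓ Z′) Z′ proj₂ D-meet D′ v∈Z′
               (λ s (s∈Z , _) → ⊥-sym (Z⊥v s∈Z)) v≉0 (u∈Z′ , u⊥v)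
        -- A vector of `Z′` orthogonal to `Z ∩ Z′` is a multiple of `v`.
        Z⊥Z′ : OrthogonalOverMeet Z Z′
        Z⊥Z′ {b} b∈Z′ b⊥ {z} z∈Z =
          let (a , u , b≈ , u∈) = split b∈Z′
              u≈0 = ⊥-self (∈-remainder (perp u) b≈ (b⊥ u u∈) (*ₗ-closed (perp u) a (⊥-sym (Z⊥v (proj₁ u∈)))))
          in ⊥-sym (respects (perp z) (≈ᴹ-sym (≈ᴹ-trans b≈ (≈ᴹ-trans (+ᴹ-congˡ u≈0) (+ᴹ-identityʳ _))))
               (*ₗ-closed (perp z) a (⊥-sym (Z⊥v z∈Z))))
        -- `b` is orthogonal to `Z ∩ Y` by `meet-grows`, hence to `Z`, and also to `v`, which lies
        -- in `Z′ ∩ Y`; by `split` this covers `Z′`.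
        Z′⊥Y : OrthogonalOverMeet Z′ Y
        Z′⊥Y {b} b∈Y b⊥ z∈Z′ =
          let (a , u , z≈ , u∈) = split z∈Z′
              Z⊥b = Z⊥Y b∈Y (λ s s∈ → b⊥ s (meet-grows D s∈ , proj₂ s∈))
          in respects (perp b) (≈ᴹ-sym z≈)
               (+-closed (perp b) (*ₗ-closed (perp b) a (⊥-sym (b⊥ v (v∈Z′ , v∈Y)))) (Z⊥b (proj₁ u∈)))

  -- Paths, distances and geodesics

  module _ {k : ℕ} where
    private module Γ = Graph (GrassmannGraph k)

    dim : (X : Grassmannian k) → Dim (subspace X) k
    dim X = HasDimension⇒Dim (subspace X) (dimension X)

    meet : (X Y : Grassmannian k) → Subspace
    meet X Y = subspace X ⊓ subspace Y

    meet-resp : ∀ {X X′ Y Y′} → X Γ.≈ⱽ X′ → Y Γ.≈ⱽ Y′ → member (meet X Y) ≐ member (meet X′ Y′)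
    meet-resp (p , p′) (q , q′) = (λ (x , y) → p x , q y) , (λ (x , y) → p′ x , q′ y)

    meet-dim : ∀ X Y → ∃[ c ] Dim (meet X Y) c
    meet-dim X Y = Dim-sub (meet X Y) (subspace X) proj₁ (dim X)

    Adjacent-respʳ : ∀ {X Y Y′} → Y Γ.≈ⱽ Y′ → Adjacent X Y → Adjacent X Y′
    Adjacent-respʳ {X} {Y} {Y′} p (j , k≡ , D) = j , k≡ , Dim⇒HasDimension (meet X Y′)
      (Dim-resp (meet X Y) (meet X Y′) (meet-resp {X} {X} {Y} {Y′} ≐-refl p) (HasDimension⇒Dim (meet X Y) D))

    edge-bound : ∀ {Z Z′ c c′} → Adjacent Z Z′ → ∀ Y → Dim (meet Z Y) c → Dim (meet Z′ Y) c′ → c′ ℕ.≤ suc c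
    edge-bound {Z} {Z′} (j , ≡.refl , D) Y = λ Dc →
      meet-bound (subspace Z) (subspace Z′) (subspace Y) (HasDimension⇒Dim (meet Z Z′) D) (dim Z′) Dc

    Edges : ∀ {n} → Vector (Grassmannian k) (suc n) → Set ℓ
    Edges {n} p = ∀ (i : Fin n) → Adjacent (p (inject₁ i)) (p (suc i))

    -- The intersection with `Y` must grow from dimension `c` to `k`, by at most one per edge. The
    -- start is left free, so that the bound applies to every tail.
    path-bound : ∀ {n c} Y (p : Vector (Grassmannian k) (suc n)) → p (fromℕ n) Γ.≈ⱽ Y → Edges p →
      Dim (meet (p zero) Y) c → k ℕ.≤ c ℕ.+ n
    path-bound {zero} {c} Y p (p⊆Y , _) edges D = ℕ.≤-trans
      (Dim-mono (subspace (p zero)) (meet (p zero) Y) (λ x → x , p⊆Y x) (dim (p zero)) D)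
      (ℕ.≤-reflexive (≡.sym (ℕ.+-identityʳ c)))
    path-bound {suc n} {c} Y p end edges D =
      let (c′ , D′) = meet-dim (p (suc zero)) Y
      in ℕ.≤-trans (path-bound Y (p ∘ suc) end (edges ∘ suc) D′)
           (ℕ.≤-trans (ℕ.+-monoˡ-≤ n (edge-bound {p zero} {p (suc zero)} (edges zero) Y D D′))
             (ℕ.≤-reflexive (≡.sym (ℕ.+-suc c n))))

    -- next is (X ∩ x^⊥) ⊕ ℂy.
    record Step (X Y : Grassmannian k) (c : ℕ) (x y : Carrierᴹ) : Set (lsuc ℓ) where
      field
        next     : Grassmannian k
        adjacent : Adjacent X next
        closer   : Dim (meet next Y) (suc c)
        y∈next   : y ∈ member (subspace next)
        section⊆ : member (subspace X ⊓ perp x) ⊆ member (subspace next)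
        meet⊆    : member (meet X next) ⊆ member (perp x)

    step : ∀ {c x y} X Y → Dim (meet X Y) c → x ∈ member (subspace X) → x ∈ member (member (meet X Y) ^⊥) →
      ¬ x ≈ᴹ 0ᴹ → y ∈ member (subspace Y) → ¬ y ∈ member (subspace X) → Step X Y c x y
    step {c} {x} {y} X Y D x∈X x⊥ x≉0 y∈Y y∉X = from ≡.refl (dim X)
      where
      W = subspace X ⊓ perp x
      X′ = adjoin W y
      from : ∀ {m} → m ≡ k → Dim (subspace X) m → Step X Y c x y
      from {zero}  _ E = contradiction (E x x∈X) x≉0
      from {suc j} ≡.refl E = record
        { next = next
        ; adjacent = j , ≡.refl , Dim⇒HasDimension (subspace X ⊓ X′) DXX′
        ; closer = closer
        ; y∈next = adjoin-self W y
        ; section⊆ = adjoin-⊆ W y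
        ; meet⊆ = λ p → proj₂ (X∩X′⊆W p)
        }
        where
        DW : Dim W j
        DW = exchange (subspace X) E x∈X x≉0
        DX′ : Dim X′ (suc j)
        DX′ = Dim-adjoin W DW (λ y∈W → y∉X (proj₁ y∈W))
        next : Grassmannian k
        next = record { subspace = X′ ; dimension = Dim⇒HasDimension X′ DX′ }
        X∩X′⊆W : member (subspace X ⊓ X′) ⊆ member W
        X∩X′⊆W {z} (z∈X , a , w , w∈W , z≈) = respects W (≈ᴹ-sym (≈ᴹ-trans z≈ (≈ᴹ-trans (+ᴹ-congʳ ay≈0) (+ᴹ-identityˡ w)))) w∈W
          where
          ay∈X = ∈-remainderˡ (subspace X) z≈ z∈X (proj₁ w∈W)
          ay≈0 : a *ₗ y ≈ᴹ 0ᴹ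
          ay≈0 = decidable-stable em λ ay≉0 →
            let (d , y≈) = multiple-sym {a} ay≉0 ≈ᴹ-refl
            in y∉X (respects (subspace X) (≈ᴹ-sym y≈) (*ₗ-closed (subspace X) d ay∈X))
        DXX′ : Dim (subspace X ⊓ X′) j
        DXX′ = Dim-resp W (subspace X ⊓ X′) ((λ w∈W → proj₁ w∈W , adjoin-⊆ W y w∈W) , X∩X′⊆W) DW
        -- `X ∩ Y` survives in `X′` because it is orthogonal to `x`, and `y` adds a dimension;
        -- `meet-bound` excludes a larger gain.
        closer : Dim (X′ ⊓ subspace Y) (suc c)
        closer =
          let (c′ , D′) = Dim-sub (X′ ⊓ subspace Y) X′ proj₁ DX′
              grown = Dim-adjoin (meet X Y) D {y} (λ y∈ → y∉X (proj₁ y∈))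
              grown⊆ : member (adjoin (meet X Y) y) ⊆ member (X′ ⊓ subspace Y)
              grown⊆ = adjoin-least (meet X Y) y (X′ ⊓ subspace Y)
                (λ {z} z∈ → adjoin-⊆ W y (proj₁ z∈ , ⊥-sym (x⊥ z z∈)) , proj₂ z∈) (adjoin-self W y , y∈Y)
              c′≡ : c′ ≡ suc c
              c′≡ = ℕ.≤-antisym (meet-bound (subspace X) X′ (subspace Y) DXX′ DX′ D D′)
                (Dim-mono (adjoin (meet X Y) y) (X′ ⊓ subspace Y) grown⊆ grown D′)
          in ≡.subst (Dim (X′ ⊓ subspace Y)) c′≡ D′

    cons-path : ∀ {n X X′ Y} → Adjacent X X′ → ∀ q → Γ.IsPath X′ Y {n} q → Γ.IsPath X Y {suc n} (X ∷ q)
    cons-path {X = X} {X′} e q (start , end , edges) = ≐-refl , end ,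
      λ { zero → Adjacent-respʳ {X} {X′} {q zero} (≐-sym start) e ; (suc i) → edges i }

    -- Each step trades one direction of `X` for one of `Y`. Carrying `c + n ≡ k` as an equation
    -- makes the recursion structural in `n`.
    path-exists : ∀ n {c} X Y → Dim (meet X Y) c → c ℕ.+ n ≡ k → ∃[ p ] Γ.IsPath X Y {n} p
    path-exists zero {c} X Y D c+0≡k = (λ _ → X) , ≐-refl , (X⊆Y , Y⊆X) , λ ()
      where
      Dk : Dim (meet X Y) k
      Dk = ≡.subst (Dim (meet X Y)) (≡.trans (≡.sym (ℕ.+-identityʳ c)) c+0≡k) D
      X⊆Y : member (subspace X) ⊆ member (subspace Y)
      X⊆Y x = proj₂ (Dim-⊆⇒⊇ (meet X Y) (subspace X) proj₁ Dk (dim X) x)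
      Y⊆X : member (subspace Y) ⊆ member (subspace X)
      Y⊆X y = proj₁ (Dim-⊆⇒⊇ (meet X Y) (subspace Y) proj₂ Dk (dim Y) y)
    path-exists (suc n) {c} X Y D c+1+n≡k =
      let (x , x∈X , x⊥ , x≉0) = proper-complement (meet X Y) (subspace X) proj₁ D (dim X) c<k
          (y , y∈Y , y⊥ , y≉0) = proper-complement (meet X Y) (subspace Y) proj₂ D (dim Y) c<k
          s = step X Y D x∈X x⊥ x≉0 y∈Y (λ y∈X → y≉0 (⊥-self (y⊥ y (y∈X , y∈Y))))
          (q , path) = path-exists n (Step.next s) Y (Step.closer s) (≡.trans (≡.sym (ℕ.+-suc c n)) c+1+n≡k)
      in X ∷ q , cons-path {X = X} {Step.next s} {Y} (Step.adjacent s) q path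
      where
      c<k : c ℕ.< k
      c<k = ℕ.≤-trans (ℕ.≤-trans (ℕ.s≤s (ℕ.m≤m+n c n)) (ℕ.≤-reflexive (≡.sym (ℕ.+-suc c n)))) (ℕ.≤-reflexive c+1+n≡k)

    path-bound′ : ∀ {n c X Y} → Dim (meet X Y) c → ∀ p → Γ.IsPath X Y {n} p → k ℕ.≤ c ℕ.+ n
    path-bound′ {X = X} {Y} D p (start , end , edges) = path-bound Y p end edges
      (Dim-resp (meet X Y) (meet (p zero) Y) (meet-resp {X} {p zero} {Y} {Y} (≐-sym start) ≐-refl) D)

    distance-bound : ∀ {n c} X Y → Dim (meet X Y) c → Γ.IsDistance X Y n → c ℕ.+ n ℕ.≤ k
    distance-bound {n} {c} X Y D (_ , minimal) =
      let c≤k = Dim-mono (meet X Y) (subspace X) proj₁ D (dim X)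
          (q , path) = path-exists (k ℕ.∸ c) X Y D (ℕ.m+[n∸m]≡n c≤k)
      in ℕ.≤-trans (ℕ.+-monoʳ-≤ c (minimal q path)) (ℕ.≤-reflexive (ℕ.m+[n∸m]≡n c≤k))

    -- `c + n ≤ k` says that no edge may be wasted: together with `path-bound` for the rest of the
    -- path it forces the gain of exactly one that `orthogonal-advance` requires.
    geodesic-edges-compatible : ∀ {n c} Y (p : Vector (Grassmannian k) (suc n)) → p (fromℕ n) Γ.≈ⱽ Y → Edges p →
      Dim (meet (p zero) Y) c → c ℕ.+ n ℕ.≤ k → OrthogonalOverMeet (subspace (p zero)) (subspace Y) →
      ∀ i → Compatible (subspace (p (inject₁ i))) (subspace (p (suc i)))
    geodesic-edges-compatible {suc n} {c} Y p end edges D c+1+n≤k Z⊥Y =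
      from (meet-dim Z′ Y) (edges zero)
      where
      Z = p zero
      Z′ = p (suc zero)
      from : ∃[ c′ ] Dim (meet Z′ Y) c′ → Adjacent Z Z′ →
        ∀ i → Compatible (subspace (p (inject₁ i))) (subspace (p (suc i)))
      from (c′ , D′) adjacent@(j , k≡1+j , E) i = edge i
        where
        c′≡1+c : c′ ≡ suc c
        c′≡1+c = ℕ.≤-antisym (edge-bound {Z} {Z′} adjacent Y D D′)
          (ℕ.+-cancelʳ-≤ n (suc c) c′ (ℕ.≤-trans (ℕ.≤-reflexive (≡.sym (ℕ.+-suc c n)))
            (ℕ.≤-trans c+1+n≤k (path-bound Y (p ∘ suc) end (edges ∘ suc) D′))))
        D″ : Dim (meet Z′ Y) (suc c)
        D″ = ≡.subst (Dim (meet Z′ Y)) c′≡1+c D′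
        advance = orthogonal-advance (subspace Z) (subspace Z′) (subspace Y) (HasDimension⇒Dim (meet Z Z′) E)
          (≡.subst (Dim (subspace Z′)) k≡1+j (dim Z′)) D D″ Z⊥Y
        edge : ∀ i → Compatible (subspace (p (inject₁ i))) (subspace (p (suc i)))
        edge zero = orthogonal⇒compatible (subspace Z) (subspace Z′) (dim Z) (dim Z′) (proj₁ advance)
        edge (suc i) = geodesic-edges-compatible Y (p ∘ suc) end (edges ∘ suc) D″
          (ℕ.≤-trans (ℕ.≤-reflexive (≡.sym (ℕ.+-suc c n))) c+1+n≤k) (proj₂ advance) i

    compatible⇒geodesics : ∀ X Y → Compatible (subspace X) (subspace Y) →
      ∀ {n} (p : Vector (Grassmannian k) (suc n)) → Γ.IsGeodesic X Y p → Graph.IsGeodesic (OrthoGrassmannGraph k) X Y p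
    compatible⇒geodesics X Y compatible p (path@(start , end , edges) , distance) =
      orthoPath , (p , orthoPath) , λ q (s , e , f) → proj₂ distance q (s , e , proj₁ ∘ f)
      where
      D = proj₂ (meet-dim X Y)
      X⊥Y : OrthogonalOverMeet (subspace X) (subspace Y)
      X⊥Y = compatible⇒orthogonal (subspace X) (subspace Y) compatible
      orthoPath : Graph.IsPath (OrthoGrassmannGraph k) X Y p
      orthoPath = start , end , λ i → edges i , geodesic-edges-compatible Y p end edges
        (Dim-resp (meet X Y) (meet (p zero) Y) (meet-resp {X} {p zero} {Y} {Y} (≐-sym start) ≐-refl) D)
        (distance-bound X Y D distance)
        (λ y∈Y y⊥ x∈ → X⊥Y y∈Y (λ s (s∈X , s∈Y) → y⊥ s (proj₂ start s∈X , s∈Y)) (proj₁ start x∈)) i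

    geodesics⇒compatible : ∀ X Y →
      (∀ {n} (p : Vector (Grassmannian k) (suc n)) → Γ.IsGeodesic X Y p → Graph.IsGeodesic (OrthoGrassmannGraph k) X Y p) →
      Compatible (subspace X) (subspace Y)
    geodesics⇒compatible X Y ortho = orthogonal⇒compatible (subspace X) (subspace Y) (dim X) (dim Y) X⊥Y
      where
      c = proj₁ (meet-dim X Y)
      D : Dim (meet X Y) c
      D = proj₂ (meet-dim X Y)

      -- A first step replacing x by y is an edge between compatible subspaces only if x ⊥ y.
      step⇒⊥ : ∀ {x y} → x ∈ member (subspace X) → Step X Y c x y → x ⊥ y
      step⇒⊥ {x} {y} x∈X s = ⊥-sym (respects (perp x) (≈ᴹ-sym y≈w+r) (+-closed (perp x) (proj₂ w∈W) (⊥-sym x⊥r)))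
        where
        open Step s
        1+c≤k : suc c ℕ.≤ k
        1+c≤k = Dim-mono (meet next Y) (subspace next) proj₁ closer (dim next)
        n = k ℕ.∸ suc c
        1+c+n≡k : suc c ℕ.+ n ≡ k
        1+c+n≡k = ℕ.m+[n∸m]≡n 1+c≤k
        rest = path-exists n next Y closer 1+c+n≡k
        q = proj₁ rest
        path : Γ.IsPath X Y {suc n} (X ∷ q)
        path = cons-path {X = X} {next} {Y} adjacent q (proj₂ rest)
        geodesic : Γ.IsGeodesic X Y {suc n} (X ∷ q)
        geodesic = path , (X ∷ q , path) , λ {m} p′ path′ → ℕ.+-cancelˡ-≤ c (suc n) m
          (ℕ.≤-trans (ℕ.≤-reflexive (≡.trans (ℕ.+-suc c n) 1+c+n≡k)) (path-bound′ {X = X} {Y} D p′ path′))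
        compatible : Compatible (subspace X) (subspace (q zero))
        compatible = proj₂ (proj₂ (proj₂ (proj₁ (ortho (X ∷ q) geodesic))) zero)
        start : q zero Γ.≈ⱽ next
        start = proj₁ (proj₂ rest)
        W = subspace X ⊓ perp x
        -- `y` is split over `W`: `w` is orthogonal to `x`, while `r` lies in `next` and is
        -- orthogonal to `X ∩ next`, so that compatibility makes it orthogonal to `x` too.
        splitting = project W (proj₂ (Dim-sub W (subspace X) proj₁ (dim X))) y
        w = proj₁ splitting
        r = proj₁ (proj₂ splitting)
        y≈w+r : y ≈ᴹ w +ᴹ r
        y≈w+r = proj₁ (proj₂ (proj₂ splitting))
        w∈W : w ∈ member W
        w∈W = proj₁ (proj₂ (proj₂ (proj₂ splitting)))
        r⊥W : r ∈ member (member W ^⊥)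
        r⊥W = proj₂ (proj₂ (proj₂ (proj₂ splitting)))
        x⊥r : x ⊥ r
        x⊥r = compatible⇒orthogonal (subspace X) (subspace (q zero)) compatible
          (proj₂ start (∈-remainder (subspace next) y≈w+r y∈next (section⊆ w∈W)))
          (λ s (s∈X , s∈q) → r⊥W s (s∈X , meet⊆ (s∈X , proj₁ start s∈q))) x∈X

      X⊥Y : OrthogonalOverMeet (subspace X) (subspace Y)
      X⊥Y {y} y∈Y y⊥ {x} x∈X =
        let (p , r , x≈p+r , p∈C , r⊥C) = project (meet X Y) D x
            r∈X = ∈-remainder (subspace X) x≈p+r x∈X (proj₁ p∈C)
            -- Assuming that `r ⊥ y` fails supplies the side conditions of `step`: `r` is nonzero,
            -- and `y` is outside `X`, since inside it would be orthogonal to itself.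
            r⊥y = decidable-stable em λ r⊥̸y → r⊥̸y (step⇒⊥ r∈X (step X Y D r∈X r⊥C
              (λ r≈0 → r⊥̸y (respects (perp y) (≈ᴹ-sym r≈0) (0-closed (perp y)))) y∈Y
              (λ y∈X → r⊥̸y (⊥-sym (respects (perp r) (≈ᴹ-sym (⊥-self (y⊥ y (y∈X , y∈Y)))) (0-closed (perp r)))))))
        in respects (perp y) (≈ᴹ-sym x≈p+r) (+-closed (perp y) (⊥-sym (y⊥ p p∈C)) r⊥y)

open import Data.Nat using (_<_)

theorem3 : (∀ {a} → ExcludedMiddle a) →
    (∀ {c ℓ₁ ℓ₂} → ZornsLemma c ℓ₁ ℓ₂) →
    ∀ {ℓ} (ℝ : RealNumbers ℓ) (H : HilbertSpace ℝ) → let open Subspaces H in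
    DimensionAtLeast 3 →
    (k : ℕ) → 0 < k → DimensionAtLeast (suc k) →
    (X Y : Grassmannian k) →
    Compatible (subspace X) (subspace Y) ⇔
    (∀ {n} (p : Vector (Grassmannian k) (suc n)) →
    Graph.IsGeodesic (GrassmannGraph k) X Y p →
    Graph.IsGeodesic (OrthoGrassmannGraph k) X Y p)
theorem3 em zorn ℝ H _ k _ _ X Y = mk⇔ (compatible⇒geodesics X Y) (geodesics⇒compatible X Y)
  where open Geodesics em zorn H
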